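{- Let $c_{\rm BSG}=\frac{21}{128}$, let $S\subseteq\mathbb F_2^n$ be nonempty and $\alpha,\rho_{\rm snd},\rho_{\rm cmp}\in(0,1)$. Fix a nonfailure record $D$ of the persistent BSG algorithm run on $S$ with these parameters, with associated fixed set $Y_D\subseteq S$, and suppose $$|Y_D|\ge c_{\rm BSG}\sqrt\alpha\,|S|.$$ Let $t\ge1$ be an integer fixed before sampling begins, and let $\rho_{\rm samp}\in(0,1)$. For each of $t$ requested samples, use an independent block of $$T:=\left\lceil\frac1{c_{\rm BSG}\sqrt\alpha}\log\frac t{\rho_{\rm samp}}\right\rceil$$ independent uniform samples from $S$, returning the first point of the block accepted by the membership predicate of $Y_D$. If any block is exhausted (contains no accepted point), return $\mathsf{FAIL}$. Then the procedure fails with probability at most $\rho_{\rm samp}$. Conditioned on success, the returned tuple has law $U_{Y_D}^{\otimes t}$. The procedure uses at most $tT$ samples from $S$ and $$O\!\left(t\,\alpha^{ -9/2}\Lambda^3\log\frac{et}{\rho_{\rm samp}}\right)$$ membership queries to $S$.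
   Context: $\log$ is base two; $U_Y$ is the uniform distribution on $Y$ and $U_Y^{\otimes t}$ its $t$-fold product. $\Lambda:=1+n+\log\frac1\alpha+\log\frac1{\rho_{\rm snd}}+\log\frac1{\rho_{\rm cmp}}$. The persistent BSG algorithm takes deterministic membership access to and exact uniform samples from $S$ and parameters $\alpha,\rho_{\rm snd},\rho_{\rm cmp}\in(0,1)$, and returns $\mathsf{FAIL}$ or a finite record $D$. The only facts about a nonfailure record used here are: $D$ determines one fixed set $Y_D\subseteq S$ with a deterministic membership predicate, and evaluating this predicate at one point uses $O(\alpha^{ -4}\Lambda^3)$ membership queries to $S$ (absolute implied constant). -}

module Defs where

open import Algebra using (CommutativeRing)
import Algebra.Properties.CommutativeSemiring.Exp as Exp
open import Data.Bool using (Bool; true; false; if_then_else_; _∧_; T)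
import Data.Bool.Properties as Bool
open import Data.Empty using (⊥; ⊥-elim)
open import Data.Integer.Base as ℤ using (ℤ; -[1+_])
open import Data.List.Base as List using (List; []; _∷_; _++_; length; map; filterᵇ; foldr)
open import Data.Maybe.Base as Maybe using (Maybe; just; nothing; is-just; is-nothing)
import Data.Maybe.Properties as Maybe
open import Data.Nat.Base as ℕ using (ℕ; zero; suc; _!)
import Data.Nat.Properties as ℕ
open import Data.Product using (Σ; Σ-syntax; ∃; ∃-syntax; _×_; _,_; proj₁; proj₂)
open import Data.Rational.Base
open import Data.Rational.Properties
open import Data.Rational.Solver using (module +-*-Solver)
open import Data.Rational.Unnormalised.Base as ℚᵘ using (*≡*)
import Data.Rational.Unnormalised.Properties as ℚᵘ
open import Data.Sum.Base using (_⊎_; inj₁; inj₂; [_,_]′)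
open import Data.Vec.Base as Vec using (Vec; []; _∷_)
import Data.Vec.Properties as Vec
open import Relation.Binary.PropositionalEquality as Eq
  using (_≡_; refl; sym; trans; cong; cong₂; subst; subst₂)
open import Relation.Binary.Definitions using (tri<; tri≈; tri>)
open import Relation.Nullary using (¬_; Dec; yes; no; does)

open Exp (CommutativeRing.commutativeSemiring +-*-commutativeRing) public
  using () renaming (_^_ to infixr 8 _^ℚ_; ^-homo-* to ^ℚ-homo-+; ^-assocʳ to ^ℚ-assoc; ^-distrib-* to ^ℚ-distrib-*)

ι : ℕ → ℚ
ι n = ℤ.+ n / 1

open +-*-Solver using (solve; _:+_; _:*_; _:-_; :-_; _:=_; con)

module Rational-Lemmas where
  abstract
    <by : ∀ {p q} d → 0ℚ < d → p + d ≡ q → p < q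
    <by {p} d 0<d refl = subst (_< p + d) (+-identityʳ p) (+-monoʳ-< p 0<d)

    ≤by : ∀ {p q} d → 0ℚ ≤ d → p + d ≡ q → p ≤ q
    ≤by {p} d 0≤d refl = subst (_≤ p + d) (+-identityʳ p) (+-monoʳ-≤ p 0≤d)

    sub-pos : ∀ {p q} → p < q → 0ℚ < q - p
    sub-pos {p} {q} p<q = subst (_< q - p) (+-inverseʳ p) (+-monoˡ-< (- p) p<q)

    sub-nn : ∀ {p q} → p ≤ q → 0ℚ ≤ q - p
    sub-nn {p} {q} p≤q = subst (_≤ q - p) (+-inverseʳ p) (+-monoˡ-≤ (- p) p≤q)

    +pos : ∀ {a b} → 0ℚ < a → 0ℚ < b → 0ℚ < a + b
    +pos 0<a 0<b = +-mono-< 0<a 0<b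

    +nn : ∀ {a b} → 0ℚ ≤ a → 0ℚ ≤ b → 0ℚ ≤ a + b
    +nn 0≤a 0≤b = +-mono-≤ 0≤a 0≤b

    +posnn : ∀ {a b} → 0ℚ < a → 0ℚ ≤ b → 0ℚ < a + b
    +posnn 0<a 0≤b = +-mono-<-≤ 0<a 0≤b

    *pos : ∀ {a b} → 0ℚ < a → 0ℚ < b → 0ℚ < a * b
    *pos {a} {b} 0<a 0<b = subst (_< a * b) (*-zeroʳ a) (*-monoʳ-<-pos a {{positive 0<a}} 0<b)

    *nn : ∀ {a b} → 0ℚ ≤ a → 0ℚ ≤ b → 0ℚ ≤ a * b
    *nn {a} {b} 0≤a 0≤b = subst (_≤ a * b) (*-zeroʳ a) (*-monoˡ-≤-nonNeg a {{nonNegative 0≤a}} 0≤b)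

    *mono-≤ : ∀ {a b c d} → 0ℚ ≤ a → 0ℚ ≤ d → a ≤ b → c ≤ d → a * c ≤ b * d
    *mono-≤ {a} {b} {c} {d} 0≤a 0≤d a≤b c≤d =
      ≤-trans (*-monoˡ-≤-nonNeg a {{nonNegative 0≤a}} c≤d) (*-monoʳ-≤-nonNeg d {{nonNegative 0≤d}} a≤b)

    *mono-< : ∀ {a b c d} → 0ℚ < a → 0ℚ < c → a < b → c < d → a * c < b * d
    *mono-< {a} {b} {c} {d} 0<a 0<c a<b c<d =
      <-trans (*-monoʳ-<-pos a {{positive 0<a}} c<d) (*-monoˡ-<-pos d {{positive (<-trans 0<c c<d)}} a<b)

    0<1 : 0ℚ < 1ℚ
    0<1 = *<* (ℤ.+<+ (ℕ.s≤s ℕ.z≤n))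

    0<½ : 0ℚ < ½
    0<½ = *<* (ℤ.+<+ (ℕ.s≤s ℕ.z≤n))

    solve-for : ∀ c e → 0ℚ < c → 0ℚ < e → ∃[ δ ] 0ℚ < δ × c * δ ≡ e
    solve-for c e 0<c 0<e = (1/ c) * e , *pos 0<1/c 0<e , eq
      where
      instance
        c-pos : Positive c
        c-pos = positive 0<c
        c-nz : NonZero c
        c-nz = pos⇒nonZero c
      0<1/c : 0ℚ < 1/ c
      0<1/c = positive⁻¹ (1/ c) {{1/pos⇒pos c}}
      eq : c * ((1/ c) * e) ≡ e
      eq = trans (sym (*-assoc c (1/ c) e)) (trans (cong (_* e) (*-inverseʳ c)) (*-identityˡ e))

    ι-homo-+ : ∀ m n → ι (m ℕ.+ n) ≡ ι m + ι n
    ι-homo-+ m n = toℚᵘ-injective (ℚᵘ.≃-trans (toℚᵘ-fromℚᵘ (ℚᵘ.mkℚᵘ (ℤ.+ (m ℕ.+ n)) 0))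
      (ℚᵘ.≃-trans (*≡* (cong (ℤ._* ℤ.+ 1) (sym (trans (cong₂ ℤ._+_ (ℤ1 m) (ℤ1 n)) refl))))
      (ℚᵘ.≃-trans (ℚᵘ.+-cong (ℚᵘ.≃-sym (toℚᵘ-fromℚᵘ (ℚᵘ.mkℚᵘ (ℤ.+ m) 0))) (ℚᵘ.≃-sym (toℚᵘ-fromℚᵘ (ℚᵘ.mkℚᵘ (ℤ.+ n) 0))))
        (ℚᵘ.≃-sym (toℚᵘ-homo-+ (ι m) (ι n))))))
      where
      open import Data.Integer.Properties as ℤ using ()
      ℤ1 : ∀ k → ℤ.+ k ℤ.* ℤ.+ 1 ≡ ℤ.+ k
      ℤ1 k = ℤ.*-identityʳ (ℤ.+ k)

    ι-homo-* : ∀ m n → ι (m ℕ.* n) ≡ ι m * ι n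
    ι-homo-* zero n = sym (*-zeroˡ (ι n))
    ι-homo-* (suc m) n = trans (ι-homo-+ n (m ℕ.* n)) (trans (cong (ι n +_) (ι-homo-* m n))
      (trans (solve 2 (λ m n → n :+ m :* n := (con 1ℚ :+ m) :* n) refl (ι m) (ι n))
        (cong (_* ι n) (sym (ι-homo-+ 1 m)))))

    ι-suc : ∀ n → ι (suc n) ≡ ι n + 1ℚ
    ι-suc n = trans (ι-homo-+ 1 n) (+-comm 1ℚ (ι n))

    ι-nn : ∀ n → 0ℚ ≤ ι n
    ι-nn n = nonNegative⁻¹ (ι n) {{normalize-nonNeg n 1}}

    ι-pos : ∀ n .{{_ : ℕ.NonZero n}} → 0ℚ < ι n
    ι-pos n = positive⁻¹ (ι n) {{normalize-pos n 1}}

    ι-mono : ∀ {m n} → m ℕ.≤ n → ι m ≤ ι n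
    ι-mono {m} {n} m≤n = ≤by (ι (n ℕ.∸ m)) (ι-nn (n ℕ.∸ m))
      (trans (sym (ι-homo-+ m (n ℕ.∸ m))) (cong ι (ℕ.m+[n∸m]≡n m≤n)))

    ι-cancel : ∀ {m n} → ι m < ι n → m ℕ.< n
    ι-cancel {m} {n} lt with n ℕ.≤? m
    ... | yes n≤m = ⊥-elim (<-irrefl refl (<-≤-trans lt (ι-mono n≤m)))
    ... | no  n≰m = ℕ.≰⇒> n≰m

    archimedes : ∀ p → ∃[ n ] p < ι n
    archimedes p@(mkℚ -[1+ k ] d c) = 0 , negative⁻¹ p
    archimedes p@(mkℚ (ℤ.+ k) d c) = suc k , toℚᵘ-cancel-<
      (ℚᵘ.<-respʳ-≃ (ℚᵘ.≃-sym (toℚᵘ-fromℚᵘ (ℚᵘ.mkℚᵘ (ℤ.+ suc k) 0)))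
        (ℚᵘ.*<* (subst₂ ℤ._<_ (sym (ℤ.*-identityʳ (ℤ.+ k))) refl
          (ℤ.+<+ (ℕ.≤-trans (ℕ.n<1+n k) (ℕ.m≤m*n (suc k) (suc d)))))))
      where import Data.Integer.Properties as ℤ

    -1< : ∀ p → p - 1ℚ < p
    -1< p = <by 1ℚ 0<1 (solve 1 (λ p → p :- con 1ℚ :+ con 1ℚ := p) refl p)

    split : ∀ p q → p < q ⊎ q ≤ p
    split p q with p <? q
    ... | yes p<q = inj₁ p<q
    ... | no  p≮q = inj₂ (≮⇒≥ p≮q)

    sum-close : ∀ {a b c d ε q r} → b < a + ε → d < c + ε → ι 2 * ε ≡ r - q → a + c ≤ q → b + d < r
    sum-close {a} {b} {c} {d} {ε} {q} {r} b< d< eq ≤q = <-≤-trans (+-mono-< b< d<)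
      (≤by (q - (a + c)) (sub-nn ≤q) (trans e1 (trans (cong (q +_) eq) e2)))
      where
      e1 : (a + ε) + (c + ε) + (q - (a + c)) ≡ q + ι 2 * ε
      e1 = solve 4 (λ a c ε q → (a :+ ε) :+ (c :+ ε) :+ (q :- (a :+ c)) := q :+ con (ι 2) :* ε) refl a c ε q
      e2 : q + (r - q) ≡ r
      e2 = solve 2 (λ q r → q :+ (r :- q) := r) refl q r

open Rational-Lemmas

-- Two-sided Dedekind cuts.  Classically `lower` determines `upper`.
record ℝ : Set₁ where
  no-eta-equality
  field
    lower upper : ℚ → Set
    lower-inhabited : ∃ lower
    upper-inhabited : ∃ upper
    lower-closed    : ∀ {p q} → p < q → lower q → lower p
    upper-closed    : ∀ {p q} → p < q → upper p → upper q
    lower-open      : ∀ {p} → lower p → ∃[ q ] p < q × lower q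
    upper-open      : ∀ {q} → upper q → ∃[ p ] p < q × upper p
    disjoint        : ∀ {q} → lower q → upper q → ⊥
    located         : ∀ {p q} → p < q → lower p ⊎ upper q

open ℝ

infix 4 _<ℝ_ _≤ℝ_

_<ℝ_ : ℝ → ℝ → Set
x <ℝ y = ∃[ q ] upper x q × lower y q

_≤ℝ_ : ℝ → ℝ → Set
x ≤ℝ y = ∀ {q} → lower x q → lower y q

lower<upper : ∀ x {p q} → lower x p → upper x q → p < q
lower<upper x {p} {q} lp uq with p <? q
... | yes p<q = p<q
... | no  p≮q with ≮⇒≥ p≮q
...   | q≤p with q ≟ p
...     | yes refl = ⊥-elim (disjoint x lp uq)
...     | no  q≢p = ⊥-elim (disjoint x lp (upper-closed x (≤∧≢⇒< q≤p q≢p) uq))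
  where
  ≤∧≢⇒< : ∀ {a b} → a ≤ b → ¬ (a ≡ b) → a < b
  ≤∧≢⇒< {a} {b} a≤b a≢b with <-cmp a b
  ... | tri< a<b _ _ = a<b
  ... | tri≈ _ a≡b _ = ⊥-elim (a≢b a≡b)
  ... | tri> _ _ b<a = ⊥-elim (<-irrefl refl (<-≤-trans b<a a≤b))

Approximation : ℝ → ℚ → ℚ → ℚ → Set
Approximation x l u ε = ∃[ a ] ∃[ b ] l ≤ a × b ≤ u × lower x a × upper x b × b < a + ε

approximate : ∀ x {l u ε} → lower x l → upper x u → 0ℚ < ε → Approximation x l u ε
approximate x {l} {u} {ε} xl xu 0<ε = clip (walk N l xl ≤-refl u<)
  where
  step = solve-for (ι 3) ε (ι-pos 3) 0<ε
  δ = proj₁ step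
  0<δ = proj₁ (proj₂ step)
  3δ≡ε = proj₂ (proj₂ step)
  count = archimedes (u - l)
  steps = solve-for δ 1ℚ 0<δ 0<1
  κ = proj₁ steps
  bound = archimedes ((u - l) * κ)
  N = proj₁ bound

  u< : u < l + ι N * δ
  u< = <by ((ι N - (u - l) * κ) * δ) (*pos (sub-pos (proj₂ bound)) 0<δ)
    (trans (solve 5 (λ u l n κ δ → u :+ (n :- (u :- l) :* κ) :* δ := u :+ n :* δ :- (u :- l) :* (δ :* κ)) refl u l (ι N) κ δ)
    (trans (cong (λ z → u + ι N * δ - (u - l) * z) (proj₂ (proj₂ steps)))
      (solve 4 (λ u l n δ → u :+ n :* δ :- (u :- l) :* con 1ℚ := l :+ n :* δ) refl u l (ι N) δ)))

  walk : ∀ n a → lower x a → l ≤ a → u < a + ι n * δ →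
    ∃[ a ] ∃[ b ] l ≤ a × lower x a × upper x b × b < a + ε
  walk zero a xa l≤a u<a = ⊥-elim (<-irrefl refl (<-trans (lower<upper x xa xu)
    (subst (u <_) (trans (cong (a +_) (*-zeroˡ δ)) (+-identityʳ a)) u<a)))
  walk (suc n) a xa l≤a u<a with located x {a + δ} {a + δ + δ} (<by δ 0<δ refl)
  ... | inj₁ xa+δ = walk n (a + δ) xa+δ (≤-trans l≤a (≤by δ (<⇒≤ 0<δ) refl))
          (subst (u <_) (trans (cong (λ z → a + z * δ) (ι-suc n))
            (solve 3 (λ a n δ → a :+ (n :+ con 1ℚ) :* δ := a :+ δ :+ n :* δ) refl a (ι n) δ)) u<a)
  ... | inj₂ xa+2δ = a , a + δ + δ , l≤a , xa , xa+2δ ,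
          <by δ 0<δ (trans (solve 2 (λ a δ → a :+ δ :+ δ :+ δ := a :+ con (ι 3) :* δ) refl a δ) (cong (a +_) 3δ≡ε))

  clip : (∃[ a ] ∃[ b ] l ≤ a × lower x a × upper x b × b < a + ε) →
    ∃[ a ] ∃[ b ] l ≤ a × b ≤ u × lower x a × upper x b × b < a + ε
  clip (a , b , l≤a , xa , xb , b<) with ≤-total b u
  ... | inj₁ b≤u = a , b , l≤a , b≤u , xa , xb , b<
  ... | inj₂ u≤b = a , u , l≤a , ≤-refl , xa , xu , ≤-<-trans u≤b b<

fromℚ : ℚ → ℝ
fromℚ p .lower q = q < p
fromℚ p .upper q = p < q
fromℚ p .lower-inhabited = p - 1ℚ , -1< p
fromℚ p .upper-inhabited = p + 1ℚ , <by 1ℚ 0<1 refl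
fromℚ p .lower-closed = <-trans
fromℚ p .upper-closed p<q r<p = <-trans r<p p<q
fromℚ p .lower-open q<p = let m , q<m , m<p = <-dense q<p in m , q<m , m<p
fromℚ p .upper-open p<q = let m , p<m , m<q = <-dense p<q in m , m<q , p<m
fromℚ p .disjoint q<p p<q = <-asym q<p p<q
fromℚ p .located {q} {r} q<r with q <? p
... | yes q<p = inj₁ q<p
... | no  q≮p = inj₂ (≤-<-trans (≮⇒≥ q≮p) q<r)

fromℕ : ℕ → ℝ
fromℕ n = fromℚ (ι n)

0ℝ 1ℝ : ℝ
0ℝ = fromℚ 0ℚ
1ℝ = fromℚ 1ℚ

infixl 6 _+ℝ_

_+ℝ_ : ℝ → ℝ → ℝ
(x +ℝ y) .lower q = ∃[ a ] ∃[ b ] lower x a × lower y b × q < a + b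
(x +ℝ y) .upper q = ∃[ a ] ∃[ b ] upper x a × upper y b × a + b < q
(x +ℝ y) .lower-inhabited = let a , xa = lower-inhabited x ; b , yb = lower-inhabited y in
  a + b - 1ℚ , a , b , xa , yb , -1< (a + b)
(x +ℝ y) .upper-inhabited = let a , xa = upper-inhabited x ; b , yb = upper-inhabited y in
  a + b + 1ℚ , a , b , xa , yb , <by 1ℚ 0<1 refl
(x +ℝ y) .lower-closed p<q (a , b , xa , yb , q<) = a , b , xa , yb , <-trans p<q q<
(x +ℝ y) .upper-closed p<q (a , b , xa , yb , <p) = a , b , xa , yb , <-trans <p p<q
(x +ℝ y) .lower-open (a , b , xa , yb , q<) = let m , q<m , m< = <-dense q< in m , q<m , a , b , xa , yb , m<
(x +ℝ y) .upper-open (a , b , xa , yb , <q) = let m , <m , m<q = <-dense <q in m , m<q , a , b , xa , yb , <m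
(x +ℝ y) .disjoint (a , b , xa , yb , q<) (c , d , xc , yd , <q) =
  <-asym (<-trans q< (+-mono-< (lower<upper x xa xc) (lower<upper y yb yd))) <q
(x +ℝ y) .located {q} {r} q<r = let ε , 0<ε , 2ε≡r-q = solve-for (ι 2) (r - q) (ι-pos 2) (sub-pos q<r) in
  decide 2ε≡r-q (approximate x (proj₂ (lower-inhabited x)) (proj₂ (upper-inhabited x)) 0<ε)
                (approximate y (proj₂ (lower-inhabited y)) (proj₂ (upper-inhabited y)) 0<ε)
  where
  decide : ∀ {l u l′ u′ ε} → ι 2 * ε ≡ r - q → Approximation x l u ε → Approximation y l′ u′ ε →
    lower (x +ℝ y) q ⊎ upper (x +ℝ y) r
  decide 2ε≡r-q (a , b , _ , _ , xa , xb , b<) (c , d , _ , _ , yc , yd , d<) =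
    [ (λ q< → inj₁ (a , c , xa , yc , q<)) ,
      (λ ≤q → inj₂ (b , d , xb , yd , sum-close {a} {b} {c} {d} b< d< 2ε≡r-q ≤q)) ]′ (split q (a + c))

-- A rational box [a , b] × [c , d] whose interior contains (x , y).
record Box (x y : ℝ) : Set where
  field
    {a b c d} : ℚ
    a<x : lower x a
    x<b : upper x b
    c<y : lower y c
    y<d : upper y d

  _∋_,_ : ℚ → ℚ → Set
  _∋_,_ e f = (a ≤ e × e ≤ b) × (c ≤ f × f ≤ d)

open Box using (_∋_,_)

module Box-Lemmas where
  ⟨_,_,_,_⟩ : ∀ {x y a b c d} → lower x a → upper x b → lower y c → upper y d → Box x y
  ⟨ p , q , r , s ⟩ = record { a<x = p ; x<b = q ; c<y = r ; y<d = s }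

  p≤∣p∣ : ∀ p → p ≤ ∣ p ∣
  p≤∣p∣ p with ≤-total 0ℚ p
  ... | inj₁ 0≤p = ≤-reflexive (sym (0≤p⇒∣p∣≡p 0≤p))
  ... | inj₂ p≤0 = ≤-trans p≤0 (0≤∣p∣ p)

  -p≤∣p∣ : ∀ p → - p ≤ ∣ p ∣
  -p≤∣p∣ p = subst (- p ≤_) (∣-p∣≡∣p∣ p) (p≤∣p∣ (- p))

  neg-nn : ∀ {p} → p ≤ 0ℚ → 0ℚ ≤ - p
  neg-nn p≤0 = neg-antimono-≤ p≤0

  abstract
    product-bound : ∀ {e u M δ} → 0ℚ ≤ δ → 0ℚ ≤ M →
      e ≤ M → - e ≤ M → u ≤ δ → - u ≤ δ → e * u ≤ M * δ
    product-bound {e} {u} {M} {δ} 0≤δ 0≤M e≤M -e≤M u≤δ -u≤δ with ≤-total 0ℚ u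
    ... | inj₁ 0≤u = ≤-trans (*-monoʳ-≤-nonNeg u {{nonNegative 0≤u}} e≤M) (*-monoˡ-≤-nonNeg M {{nonNegative 0≤M}} u≤δ)
    ... | inj₂ u≤0 = subst (_≤ M * δ) (solve 2 (λ e u → (:- e) :* (:- u) := e :* u) refl e u)
      (≤-trans (*-monoʳ-≤-nonNeg (- u) {{nonNegative (neg-nn u≤0)}} -e≤M) (*-monoˡ-≤-nonNeg M {{nonNegative 0≤M}} -u≤δ))

    close : ∀ a b e e′ δ → b < a + δ → a ≤ e → e ≤ b → a ≤ e′ → e′ ≤ b → e - e′ ≤ δ
    close a b e e′ δ b< a≤e e≤b a≤e′ e′≤b = ≤by ((b - e) + (e′ - a) + (a + δ - b))
      (+nn (+nn (sub-nn e≤b) (sub-nn a≤e′)) (sub-nn (<⇒≤ b<)))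
      (solve 5 (λ a b e e′ δ → e :- e′ :+ ((b :- e) :+ (e′ :- a) :+ (a :+ δ :- b)) := δ) refl a b e e′ δ)

    flip- : ∀ p q s → p - q ≤ s → - (q - p) ≤ s
    flip- p q s = subst (_≤ s) (solve 2 (λ p q → p :- q := :- (q :- p)) refl p q)

    product-close : ∀ {e f e′ f′ M M′ δ} → 0ℚ ≤ δ → 0ℚ ≤ M → 0ℚ ≤ M′ →
      e ≤ M × - e ≤ M → f′ ≤ M′ × - f′ ≤ M′ →
      e - e′ ≤ δ × e′ - e ≤ δ → f - f′ ≤ δ × f′ - f ≤ δ →
      e * f - e′ * f′ ≤ (M + M′) * δ
    product-close {e} {f} {e′} {f′} {M} {M′} {δ} 0≤δ 0≤M 0≤M′ (e≤ , -e≤) (f′≤ , -f′≤) (e-e′ , e′-e) (f-f′ , f′-f) =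
      subst₂ _≤_ (solve 4 (λ e f e′ f′ → e :* (f :- f′) :+ f′ :* (e :- e′) := e :* f :- e′ :* f′) refl e f e′ f′)
        (sym (*-distribʳ-+ δ M M′))
        (+-mono-≤ (product-bound 0≤δ 0≤M e≤ -e≤ f-f′ (flip- f′ f δ f′-f))
                  (product-bound 0≤δ 0≤M′ f′≤ -f′≤ e-e′ (flip- e′ e δ e′-e)))

    below : ∀ p s w → p - s ≤ w → p - w ≤ s
    below p s w h = ≤by (w - (p - s)) (sub-nn h) (solve 3 (λ p s w → (p :- w) :+ (w :- (p :- s)) := s) refl p s w)

    above : ∀ p s w → s - p ≤ w → s ≤ p + w
    above p s w h = ≤by (w - (s - p)) (sub-nn h) (solve 3 (λ p s w → s :+ (w :- (s :- p)) := p :+ w) refl p s w)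

    box-gap : ∀ p q r M M′ δ → 0ℚ < δ → (ι 2 * (M + M′) + 1ℚ) * δ ≡ r - q → p - (M + M′) * δ ≤ q → p + (M + M′) * δ < r
    box-gap p q r M M′ δ 0<δ eq ≤q = <by (δ + (q - (p - (M + M′) * δ))) (+posnn 0<δ (sub-nn ≤q))
      (trans (solve 5 (λ m m′ δ q p → p :+ (m :+ m′) :* δ :+ (δ :+ (q :- (p :- (m :+ m′) :* δ))) := q :+ (con (ι 2) :* (m :+ m′) :+ con 1ℚ) :* δ) refl M M′ δ q p)
        (trans (cong (q +_) eq) (solve 2 (λ q r → q :+ (r :- q) := r) refl q r)))

    product-lower : ∀ {e f M M′} → 0ℚ ≤ M → 0ℚ ≤ M′ → e ≤ M × - e ≤ M → f ≤ M′ × - f ≤ M′ → - (M * M′) ≤ e * f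
    product-lower {e} {f} {M} {M′} 0≤M 0≤M′ (e≤ , -e≤) (f≤ , -f≤) =
      subst (- (M * M′) ≤_) (solve 2 (λ e f → :- (e :* (:- f)) := e :* f) refl e f)
        (neg-antimono-≤ (product-bound 0≤M′ 0≤M e≤ -e≤ -f≤ (subst (_≤ M′) (solve 1 (λ f → f := :- (:- f)) refl f) f≤)))

  bound : (x : ℝ) → ∃[ l ] ∃[ u ] ∃[ M ] lower x l × upper x u × 0ℚ ≤ M × (∀ {e} → l ≤ e → e ≤ u → e ≤ M × - e ≤ M)
  bound x = let l , xl = lower-inhabited x ; u , xu = upper-inhabited x in
    l , u , ∣ l ∣ + ∣ u ∣ , xl , xu , +nn (0≤∣p∣ l) (0≤∣p∣ u) , λ l≤e e≤u →
      ≤-trans e≤u (≤-trans (p≤∣p∣ u) (≤by ∣ l ∣ (0≤∣p∣ l) (+-comm ∣ u ∣ ∣ l ∣))) ,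
      ≤-trans (neg-antimono-≤ l≤e) (≤-trans (-p≤∣p∣ l) (≤by ∣ u ∣ (0≤∣p∣ u) refl))

  boxed : ∀ {x y} (B B′ : Box x y) → ∃[ e ] ∃[ f ] (B ∋ e , f) × (B′ ∋ e , f)
  boxed {x} {y} B B′ = _ , _ ,
    ((p≤p⊔q _ _ , ⊔-lub (<⇒≤ (lower<upper x B.a<x B.x<b)) (<⇒≤ (lower<upper x B′.a<x B.x<b))) ,
     (p≤p⊔q _ _ , ⊔-lub (<⇒≤ (lower<upper y B.c<y B.y<d)) (<⇒≤ (lower<upper y B′.c<y B.y<d)))) ,
    ((p≤q⊔p B.a B′.a , ⊔-lub (<⇒≤ (lower<upper x B.a<x B′.x<b)) (<⇒≤ (lower<upper x B′.a<x B′.x<b))) ,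
     (p≤q⊔p B.c B′.c , ⊔-lub (<⇒≤ (lower<upper y B.c<y B′.y<d)) (<⇒≤ (lower<upper y B′.c<y B′.y<d))))
    where
    module B = Box B
    module B′ = Box B′

open Box-Lemmas

infixl 7 _*ℝ_

_*ℝ_ : ℝ → ℝ → ℝ
(x *ℝ y) .lower q = Σ[ B ∈ Box x y ] ∃[ p ] q < p × (∀ e f → B ∋ e , f → p ≤ e * f)
(x *ℝ y) .upper q = Σ[ B ∈ Box x y ] ∃[ p ] p < q × (∀ e f → B ∋ e , f → e * f ≤ p)
(x *ℝ y) .lower-inhabited =
  let l , u , M , xl , xu , 0≤M , x≤ = bound x
      l′ , u′ , M′ , yl , yu , 0≤M′ , y≤ = bound y in
  - (M * M′) - 1ℚ , ⟨ xl , xu , yl , yu ⟩ , - (M * M′) , -1< (- (M * M′)) ,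
  λ e f ((l≤e , e≤u) , (l≤f , f≤u)) → product-lower 0≤M 0≤M′ (x≤ l≤e e≤u) (y≤ l≤f f≤u)
(x *ℝ y) .upper-inhabited =
  let l , u , M , xl , xu , 0≤M , x≤ = bound x
      l′ , u′ , M′ , yl , yu , 0≤M′ , y≤ = bound y in
  M * M′ + 1ℚ , ⟨ xl , xu , yl , yu ⟩ , M * M′ , <by 1ℚ 0<1 refl ,
  λ e f ((l≤e , e≤u) , (l≤f , f≤u)) →
    product-bound 0≤M′ 0≤M (proj₁ (x≤ l≤e e≤u)) (proj₂ (x≤ l≤e e≤u)) (proj₁ (y≤ l≤f f≤u)) (proj₂ (y≤ l≤f f≤u))
(x *ℝ y) .lower-closed p<q (B , p , q<p , h) = B , p , <-trans p<q q<p , h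
(x *ℝ y) .upper-closed p<q (B , p , p<p′ , h) = B , p , <-trans p<p′ p<q , h
(x *ℝ y) .lower-open (B , p , q<p , h) = let m , q<m , m<p = <-dense q<p in m , q<m , B , p , m<p , h
(x *ℝ y) .upper-open (B , p , p<q , h) = let m , p<m , m<q = <-dense p<q in m , m<q , B , p , p<m , h
(x *ℝ y) .disjoint (B , p , q<p , h) (B′ , p′ , p′<q , h′) = let e , f , i , i′ = boxed B B′ in
  <-irrefl refl (<-trans q<p (≤-<-trans (≤-trans (h e f i) (h′ e f i′)) p′<q))
(x *ℝ y) .located {q} {r} q<r =
  let l , u , M , xl , xu , 0≤M , x≤ = bound x
      l′ , u′ , M′ , yl , yu , 0≤M′ , y≤ = bound y
      δ , 0<δ , eq = solve-for (ι 2 * (M + M′) + 1ℚ) (r - q) (+-mono-≤-< (*nn (ι-nn 2) (+nn 0≤M 0≤M′)) 0<1) (sub-pos q<r)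
  in decide 0≤M 0≤M′ x≤ y≤ 0<δ eq (approximate x xl xu 0<δ) (approximate y yl yu 0<δ)
  where
  decide : ∀ {l u M l′ u′ M′ δ} → 0ℚ ≤ M → 0ℚ ≤ M′ →
    (∀ {e} → l ≤ e → e ≤ u → e ≤ M × - e ≤ M) → (∀ {f} → l′ ≤ f → f ≤ u′ → f ≤ M′ × - f ≤ M′) →
    0ℚ < δ → (ι 2 * (M + M′) + 1ℚ) * δ ≡ r - q → Approximation x l u δ → Approximation y l′ u′ δ →
    lower (x *ℝ y) q ⊎ upper (x *ℝ y) r
  decide {l} {u} {M} {l′} {u′} {M′} {δ} 0≤M 0≤M′ x≤ y≤ 0<δ eq
    (a , b , l≤a , b≤u , xa , xb , b<) (c , d , l≤c , d≤u , yc , yd , d<) =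
    [ (λ q< → inj₁ (B , a * c - w , q< , λ e f i → below (a * c) (e * f) w (diff a c e f corner i))) ,
      (λ ≤q → inj₂ (B , a * c + w , box-gap (a * c) q r M M′ δ 0<δ eq ≤q ,
        λ e f i → above (a * c) (e * f) w (diff e f a c i corner))) ]′ (split q (a * c - w))
    where
    B : Box x y
    B = ⟨ xa , xb , yc , yd ⟩
    w : ℚ
    w = (M + M′) * δ
    corner : B ∋ a , c
    corner = (≤-refl , <⇒≤ (lower<upper x xa xb)) , (≤-refl , <⇒≤ (lower<upper y yc yd))
    diff : ∀ e f e′ f′ → B ∋ e , f → B ∋ e′ , f′ → e * f - e′ * f′ ≤ w
    diff e f e′ f′ ((ae , eb) , (cf , fd)) ((ae′ , eb′) , (cf′ , fd′)) =
      product-close (<⇒≤ 0<δ) 0≤M 0≤M′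
        (x≤ (≤-trans l≤a ae) (≤-trans eb b≤u)) (y≤ (≤-trans l≤c cf′) (≤-trans fd′ d≤u))
        (close a b e e′ δ b< ae eb ae′ eb′ , close a b e′ e δ b< ae′ eb′ ae eb)
        (close c d f f′ δ d< cf fd cf′ fd′ , close c d f′ f δ d< cf′ fd′ cf fd)

infixr 8 _^ℝ_

_^ℝ_ : ℝ → ℕ → ℝ
x ^ℝ zero  = 1ℝ
x ^ℝ suc n = x *ℝ x ^ℝ n
record IsPositive (x : ℝ) : Set where
  constructor is-positive
  field
    {witness} : ℚ
    0<witness : 0ℚ < witness
    witness<x : lower x witness

module Reciprocal-Lemmas where
  pos-upper : ∀ x {{_ : IsPositive x}} {u} → upper x u → 0ℚ < u
  pos-upper x {{is-positive 0<w w<x}} x<u = <-trans 0<w (lower<upper x w<x x<u)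

  abstract
    slack-above : ∀ {q r s} → 0ℚ < r → q * r < s → ∃[ m ] q < m × m * r < s
    slack-above {q} {r} {s} 0<r h with <-dense h
    ... | z , qr<z , z<s with solve-for r (z - q * r) 0<r (sub-pos qr<z)
    ...   | δ , 0<δ , eq = q + δ , <by δ 0<δ refl , subst (_< s) (sym (trans
            (solve 3 (λ q r δ → (q :+ δ) :* r := q :* r :+ r :* δ) refl q r δ)
            (trans (cong (q * r +_) eq) (solve 2 (λ z w → w :+ (z :- w) := z) refl z (q * r))))) z<s

    slack-below : ∀ {q r s} → 0ℚ < r → s < q * r → ∃[ m ] m < q × s < m * r
    slack-below {q} {r} {s} 0<r h with <-dense h
    ... | z , s<z , z<qr with solve-for r (q * r - z) 0<r (sub-pos z<qr)
    ...   | δ , 0<δ , eq = q - δ , <by δ 0<δ (solve 2 (λ q δ → q :- δ :+ δ := q) refl q δ) , subst (s <_) (sym (trans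
            (solve 3 (λ q r δ → (q :- δ) :* r := q :* r :- r :* δ) refl q r δ)
            (trans (cong (λ t → q * r - t) eq) (solve 2 (λ z w → w :- (w :- z) := z) refl z (q * r))))) s<z

    *mono-<ʳ : ∀ {a b r} → 0ℚ < r → a < b → a * r < b * r
    *mono-<ʳ {r = r} 0<r a<b = *-monoˡ-<-pos r {{positive 0<r}} a<b

    nonpos-* : ∀ {a b} → a ≤ 0ℚ → 0ℚ ≤ b → a * b ≤ 0ℚ
    nonpos-* {a} {b} a≤0 0≤b = subst (a * b ≤_) (*-zeroˡ b) (*-monoʳ-≤-nonNeg b {{nonNegative 0≤b}} a≤0)

    inverse-disjoint : ∀ {q r s} → 0ℚ < s → s < r → q * r < 1ℚ → 1ℚ < q * s → ⊥
    inverse-disjoint {q} {r} {s} 0<s s<r qr<1 1<qs with split 0ℚ q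
    ... | inj₁ 0<q = <-asym 1<qs (<-trans (*-monoʳ-<-pos q {{positive 0<q}} s<r) qr<1)
    ... | inj₂ q≤0 = <-asym 1<qs (≤-<-trans (nonpos-* q≤0 (<⇒≤ 0<s)) 0<1)

    inverse-located : ∀ {q r} → 0ℚ < q → q < r → ∃[ i ] ∃[ j ] 0ℚ < i × i < j × 1ℚ < r * i × q * j < 1ℚ
    inverse-located {q} {r} 0<q q<r with <-dense q<r
    ... | m , q<m , m<r with <-dense q<m
    ...   | m′ , q<m′ , m′<m with solve-for m 1ℚ (<-trans 0<q q<m) 0<1 | solve-for m′ 1ℚ (<-trans 0<q q<m′) 0<1
    ...     | i , 0<i , mi≡1 | j , 0<j , m′j≡1 = i , j , 0<i , i<j ,
              subst (_< r * i) mi≡1 (*mono-<ʳ 0<i m<r) , subst (q * j <_) m′j≡1 (*mono-<ʳ 0<j q<m′)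
      where
      i<j : i < j
      i<j with split i j
      ... | inj₁ i<j = i<j
      ... | inj₂ j≤i = ⊥-elim (<-irrefl (trans m′j≡1 (sym mi≡1))
              (≤-<-trans (*-monoˡ-≤-nonNeg m′ {{nonNegative (<⇒≤ (<-trans 0<q q<m′))}} j≤i) (*mono-<ʳ 0<i m′<m)))

open Reciprocal-Lemmas

infix 9 _⁻¹

_⁻¹ : (x : ℝ) {{_ : IsPositive x}} → ℝ
(x ⁻¹) .lower q = ∃[ r ] upper x r × q * r < 1ℚ
(x ⁻¹) .upper q = ∃[ r ] 0ℚ < r × lower x r × 1ℚ < q * r
(x ⁻¹) .lower-inhabited = let u , x<u = upper-inhabited x in
  0ℚ , u , x<u , subst (_< 1ℚ) (sym (*-zeroˡ u)) 0<1
(_⁻¹ x {{is-positive {w} 0<w w<x}}) .upper-inhabited = let δ , _ , eq = solve-for w (ι 2) 0<w (ι-pos 2) in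
  δ , w , 0<w , w<x , subst (1ℚ <_) (trans (sym eq) (*-comm w δ)) (<by 1ℚ 0<1 refl)
(x ⁻¹) .lower-closed p<q (r , x<r , h) = r , x<r , <-trans (*mono-<ʳ (pos-upper x x<r) p<q) h
(x ⁻¹) .upper-closed p<q (r , 0<r , r<x , h) = r , 0<r , r<x , <-trans h (*mono-<ʳ 0<r p<q)
(x ⁻¹) .lower-open (r , x<r , h) = let m , q<m , h′ = slack-above (pos-upper x x<r) h in m , q<m , r , x<r , h′
(x ⁻¹) .upper-open (r , 0<r , r<x , h) = let m , m<q , h′ = slack-below 0<r h in m , m<q , r , 0<r , r<x , h′
(x ⁻¹) .disjoint {q} (r , x<r , h) (s , 0<s , s<x , h′) = inverse-disjoint {q} 0<s (lower<upper x s<x x<r) h h′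
(x ⁻¹) .located {q} {r} q<r = [ positive-case , nonpositive-case ]′ (split 0ℚ q)
  where
  positive-case : 0ℚ < q → lower (x ⁻¹) q ⊎ upper (x ⁻¹) r
  positive-case 0<q = let i , j , 0<i , i<j , 1<ri , qj<1 = inverse-located 0<q q<r in
    [ (λ i<x → inj₂ (i , 0<i , i<x , 1<ri)) , (λ x<j → inj₁ (j , x<j , qj<1)) ]′ (located x i<j)
  nonpositive-case : q ≤ 0ℚ → lower (x ⁻¹) q ⊎ upper (x ⁻¹) r
  nonpositive-case q≤0 = let u , x<u = upper-inhabited x in
    inj₁ (u , x<u , ≤-<-trans (nonpos-* q≤0 (<⇒≤ (pos-upper x x<u))) 0<1)

module Square-Lemmas where
  abstract
    square-above : ∀ u → u < (∣ u ∣ + 1ℚ) * (∣ u ∣ + 1ℚ)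
    square-above u = ≤-<-trans (p≤∣p∣ u) (<by (∣ u ∣ * ∣ u ∣ + ∣ u ∣ + 1ℚ) (+-mono-≤-< (+nn (*nn (0≤∣p∣ u) (0≤∣p∣ u)) (0≤∣p∣ u)) 0<1)
      (solve 1 (λ v → v :+ (v :* v :+ v :+ con 1ℚ) := (v :+ con 1ℚ) :* (v :+ con 1ℚ)) refl ∣ u ∣))

    square-mono : ∀ {a b} → 0ℚ ≤ a → a ≤ b → a * a ≤ b * b
    square-mono 0≤a a≤b = *mono-≤ 0≤a (≤-trans 0≤a a≤b) a≤b a≤b

open Square-Lemmas

infix 9 √_

-- √ x is the nonnegative square root of max(x , 0).
√_ : ℝ → ℝ
(√ x) .lower q = ∃[ r ] q < r × (r ≤ 0ℚ ⊎ lower x (r * r))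
(√ x) .upper q = ∃[ r ] r < q × 0ℚ ≤ r × upper x (r * r)
(√ x) .lower-inhabited = 0ℚ - 1ℚ , 0ℚ , -1< 0ℚ , inj₁ ≤-refl
(√ x) .upper-inhabited = let u , x<u = upper-inhabited x in
  ∣ u ∣ + 1ℚ + 1ℚ , ∣ u ∣ + 1ℚ , <by 1ℚ 0<1 refl , +nn (0≤∣p∣ u) (<⇒≤ 0<1) , upper-closed x (square-above u) x<u
(√ x) .lower-closed p<q (r , q<r , h) = r , <-trans p<q q<r , h
(√ x) .upper-closed p<q (r , r<p , h) = r , <-trans r<p p<q , h
(√ x) .lower-open (r , q<r , h) = let m , q<m , m<r = <-dense q<r in m , q<m , r , m<r , h
(√ x) .upper-open (r , r<q , h) = let m , r<m , m<q = <-dense r<q in m , m<q , r , r<m , h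
(√ x) .disjoint (r , q<r , inj₁ r≤0) (s , s<q , 0≤s , x<ss) = <-irrefl refl (≤-<-trans 0≤s (<-trans s<q (<-≤-trans q<r r≤0)))
(√ x) .disjoint (r , q<r , inj₂ rr<x) (s , s<q , 0≤s , x<ss) =
  <-irrefl refl (<-≤-trans (lower<upper x rr<x x<ss) (square-mono 0≤s (<⇒≤ (<-trans s<q q<r))))
(√ x) .located {q} {r} q<r =
  let m , q<m , m<r = <-dense q<r
      n , q<n , n<m = <-dense q<m in
  [ (λ 0<n → [ (λ nn<x → inj₁ (n , q<n , inj₂ nn<x)) , (λ x<mm → inj₂ (m , m<r , <⇒≤ (<-trans 0<n n<m) , x<mm)) ]′
      (located x (*mono-< 0<n 0<n n<m n<m))) ,
    (λ n≤0 → inj₁ (n , q<n , inj₁ n≤0)) ]′ (split 0ℚ n)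

module Power-Lemmas where
  abstract
    ^-nn : ∀ {a} n → 0ℚ ≤ a → 0ℚ ≤ a ^ℚ n
    ^-nn zero 0≤a = <⇒≤ 0<1
    ^-nn (suc n) 0≤a = *nn 0≤a (^-nn n 0≤a)

    ^-pos : ∀ {a} n → 0ℚ < a → 0ℚ < a ^ℚ n
    ^-pos zero 0<a = 0<1
    ^-pos (suc n) 0<a = *pos 0<a (^-pos n 0<a)

    ^-mono : ∀ {a b} n → 0ℚ ≤ a → a ≤ b → a ^ℚ n ≤ b ^ℚ n
    ^-mono zero 0≤a a≤b = ≤-refl
    ^-mono (suc n) 0≤a a≤b = *mono-≤ 0≤a (^-nn n (≤-trans 0≤a a≤b)) a≤b (^-mono n 0≤a a≤b)

    1≤2^ : ∀ n → 1ℚ ≤ ι 2 ^ℚ n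
    1≤2^ zero = ≤-refl
    1≤2^ (suc n) = subst (_≤ ι 2 * ι 2 ^ℚ n) (*-identityˡ 1ℚ)
      (*mono-≤ (<⇒≤ 0<1) (^-nn n (ι-nn 2)) (≤by 1ℚ (<⇒≤ 0<1) refl) (1≤2^ n))

    2^-suc : ∀ n → ι 2 ^ℚ n < ι 2 ^ℚ suc n
    2^-suc n = <by (ι 2 ^ℚ n) (^-pos n (ι-pos 2)) (solve 1 (λ z → z :+ z := con (ι 2) :* z) refl (ι 2 ^ℚ n))

    2^-mono-≤ : ∀ {m n} → m ℕ.≤ n → ι 2 ^ℚ m ≤ ι 2 ^ℚ n
    2^-mono-≤ {m} {n} m≤n = subst₂ _≤_ (*-identityʳ (ι 2 ^ℚ m))
      (trans (sym (^ℚ-homo-+ (ι 2) m (n ℕ.∸ m))) (cong (ι 2 ^ℚ_) (ℕ.m+[n∸m]≡n m≤n)))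
      (*-monoˡ-≤-nonNeg (ι 2 ^ℚ m) {{nonNegative (^-nn m (ι-nn 2))}} (1≤2^ (n ℕ.∸ m)))

    2^-cancel-≤ : ∀ {m n} → ι 2 ^ℚ m ≤ ι 2 ^ℚ n → m ℕ.≤ n
    2^-cancel-≤ {m} {n} h with m ℕ.≤? n
    ... | yes m≤n = m≤n
    ... | no  m≰n = ⊥-elim (<-irrefl refl (<-≤-trans (2^-suc n) (≤-trans (2^-mono-≤ (ℕ.≰⇒> m≰n)) h)))

    bernoulli : ∀ {a δ} n → 0ℚ ≤ a → 0ℚ ≤ δ → (a + δ) ^ℚ n * (a - ι n * δ) ≤ a ^ℚ n * a
    bernoulli {a} {δ} zero 0≤a 0≤δ = ≤-reflexive
      (solve 2 (λ a δ → con 1ℚ :* (a :- con 0ℚ :* δ) := con 1ℚ :* a) refl a δ)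
    bernoulli {a} {δ} (suc n) 0≤a 0≤δ = ≤-trans
      (≤by ((a + δ) ^ℚ n * (ι (suc n) * δ * δ)) (*nn (^-nn n (+nn 0≤a 0≤δ)) (*nn (*nn (ι-nn (suc n)) 0≤δ) 0≤δ))
        (trans (cong (λ z → (a + δ) * (a + δ) ^ℚ n * (a - z * δ) + (a + δ) ^ℚ n * (z * δ * δ)) (ι-suc n))
          (solve 4 (λ a δ n p → (a :+ δ) :* p :* (a :- (n :+ con 1ℚ) :* δ) :+ p :* ((n :+ con 1ℚ) :* δ :* δ) := a :* (p :* (a :- n :* δ))) refl a δ (ι n) ((a + δ) ^ℚ n))))
      (≤-trans (*-monoˡ-≤-nonNeg a {{nonNegative 0≤a}} (bernoulli n 0≤a 0≤δ)) (≤-reflexive (sym (*-assoc a (a ^ℚ n) a))))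

    power-close : ∀ {a δ} n → 0ℚ < a → 0ℚ ≤ δ → ι 2 * (ι n * δ) ≤ a → (a + δ) ^ℚ n ≤ ι 2 * a ^ℚ n
    power-close {a} {δ} n 0<a 0≤δ small = *-cancelʳ-≤-pos a {{positive 0<a}} (≤-trans
      (≤by (P * (a - ι 2 * (ι n * δ))) (*nn (^-nn n (+nn (<⇒≤ 0<a) 0≤δ)) (sub-nn small))
        (solve 3 (λ p a w → p :* a :+ p :* (a :- con (ι 2) :* w) := con (ι 2) :* (p :* (a :- w))) refl P a (ι n * δ)))
      (≤-trans (*-monoˡ-≤-nonNeg (ι 2) (bernoulli n (<⇒≤ 0<a) 0≤δ)) (≤-reflexive (sym (*-assoc (ι 2) (a ^ℚ n) a)))))
      where
      P : ℚ
      P = (a + δ) ^ℚ n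

    ℕ-above : ∀ N {z} → 0ℚ ≤ z → z < ι N → ∃[ m ] z < ι m × ι m ≤ z + 1ℚ
    ℕ-above zero 0≤z z<0 = ⊥-elim (<-irrefl refl (≤-<-trans 0≤z z<0))
    ℕ-above (suc N) {z} 0≤z z<N with split z (ι N)
    ... | inj₁ z<N′ = ℕ-above N 0≤z z<N′
    ... | inj₂ N≤z = suc N , z<N , subst (_≤ z + 1ℚ) (sym (ι-suc N)) (+-monoˡ-≤ 1ℚ N≤z)

    -- Consecutive fractions (m - k)/(b+1) < (m + 1 - k)/(b+1) strictly between q and r.
    fractions-between : ∀ {q r} → q < r → ∃[ m ] ∃[ k ] ∃[ b ]
      q * ι (suc b) < ι m - ι k × ι (suc m) - ι k < r * ι (suc b)
    fractions-between {q} {r} q<r =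
      let δ , 0<δ , eq = solve-for (r - q) (ι 2) (sub-pos q<r) (ι-pos 2)
          b , δ<b = archimedes δ
          k , -q<k = archimedes (- (q * ι (suc b)))
          N , z<N = archimedes (q * ι (suc b) + ι k)
          m , z<m , m≤z+1 = ℕ-above N (nn {k} -q<k) z<N
      in m , k , b , lo {ι (suc b)} {ι k} {ι m} z<m , hi {ι (suc b)} {ι k} {m} {δ} (<-≤-trans δ<b (ι-mono (ℕ.n≤1+n b))) eq m≤z+1
      where
      nn : ∀ {k w} → - w < ι k → 0ℚ ≤ w + ι k
      nn {k} {w} h = subst (0ℚ ≤_) (solve 2 (λ k w → k :- (:- w) := w :+ k) refl (ι k) w) (<⇒≤ (sub-pos h))
      lo : ∀ {β k m} → q * β + k < m → q * β < m - k
      lo {β} {k} {m} h = <by (m - (q * β + k)) (sub-pos h)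
        (solve 3 (λ w k m → w :+ (m :- (w :+ k)) := m :- k) refl (q * β) k m)
      hi : ∀ {β k m δ} → δ < β → (r - q) * δ ≡ ι 2 → ι m ≤ q * β + k + 1ℚ → ι (suc m) - k < r * β
      hi {β} {k} {m} {δ} δ<β eq h = <by ((q * β + k + 1ℚ - ι m) + ((r - q) * (β - δ)))
        (+-mono-≤-< (sub-nn h) (*pos (sub-pos q<r) (sub-pos δ<β)))
        (trans (cong (λ s → s - k + ((q * β + k + 1ℚ - ι m) + ((r - q) * (β - δ)))) (ι-suc m))
        (trans (solve 6 (λ q r k m β δ → m :+ con 1ℚ :- k :+ ((q :* β :+ k :+ con 1ℚ :- m) :+ (r :- q) :* (β :- δ)) := con (ι 2) :- (r :- q) :* δ :+ r :* β) refl q r k (ι m) β δ)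
        (trans (cong (λ s → ι 2 - s + r * β) eq) (solve 1 (λ w → con (ι 2) :- con (ι 2) :+ w := w) refl (r * β)))))

    frac-disjoint : ∀ {q m k b m′ k′ b′} →
      q * ι (suc b) < ι m - ι k → ι m′ - ι k′ < q * ι (suc b′) →
      m ℕ.* suc b′ ℕ.+ k′ ℕ.* suc b ℕ.≤ k ℕ.* suc b′ ℕ.+ m′ ℕ.* suc b → ⊥
    frac-disjoint {q} {m} {k} {b} {m′} {k′} {b′} h h′ le = <-irrefl refl (<-≤-trans lt (subst₂ _≤_ (expand m k′) (expand k m′) (ι-mono le)))
      where
      B B′ : ℚ
      B = ι (suc b)
      B′ = ι (suc b′)
      expand : ∀ i j → ι (i ℕ.* suc b′ ℕ.+ j ℕ.* suc b) ≡ ι i * B′ + ι j * B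
      expand i j = trans (ι-homo-+ (i ℕ.* suc b′) (j ℕ.* suc b)) (cong₂ _+_ (ι-homo-* i (suc b′)) (ι-homo-* j (suc b)))
      lt : ι k * B′ + ι m′ * B < ι m * B′ + ι k′ * B
      lt = <by ((ι m - ι k - q * B) * B′ + (q * B′ - (ι m′ - ι k′)) * B)
        (+pos (*pos (sub-pos h) (ι-pos (suc b′))) (*pos (sub-pos h′) (ι-pos (suc b))))
        (solve 7 (λ m k m′ k′ q B B′ → k :* B′ :+ m′ :* B :+ ((m :- k :- q :* B) :* B′ :+ (q :* B′ :- (m′ :- k′)) :* B) := m :* B′ :+ k′ :* B)
          refl (ι m) (ι k) (ι m′) (ι k′) q B B′)

    power-disjoint : ∀ {a a′ m k b m′ k′ b′} → 0ℚ < a → a < a′ →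
      ι 2 ^ℚ m ≤ ι 2 ^ℚ k * a ^ℚ suc b → ι 2 ^ℚ k′ * a′ ^ℚ suc b′ ≤ ι 2 ^ℚ m′ →
      m ℕ.* suc b′ ℕ.+ k′ ℕ.* suc b ℕ.≤ k ℕ.* suc b′ ℕ.+ m′ ℕ.* suc b
    power-disjoint {a} {a′} {m} {k} {b} {m′} {k′} {b′} 0<a a<a′ h h′ =
      2^-cancel-≤ (subst₂ _≤_ (sym (^ℚ-homo-+ (ι 2) (m ℕ.* B′) (k′ ℕ.* B))) (sym (^ℚ-homo-+ (ι 2) (k ℕ.* B′) (m′ ℕ.* B)))
        (*-cancelʳ-≤-pos (a ^ℚ (B ℕ.* B′)) {{positive (^-pos (B ℕ.* B′) 0<a)}} chain))
      where
      B B′ : ℕ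
      B = suc b
      B′ = suc b′
      0≤2^ : ∀ n → 0ℚ ≤ ι 2 ^ℚ n
      0≤2^ n = ^-nn n (ι-nn 2)
      p1 : ι 2 ^ℚ (m ℕ.* B′) ≤ ι 2 ^ℚ (k ℕ.* B′) * a ^ℚ (B ℕ.* B′)
      p1 = subst₂ _≤_ (^ℚ-assoc (ι 2) m B′)
        (trans (^ℚ-distrib-* (ι 2 ^ℚ k) (a ^ℚ B) B′) (cong₂ _*_ (^ℚ-assoc (ι 2) k B′) (^ℚ-assoc a B B′)))
        (^-mono B′ (0≤2^ m) h)
      p2 : ι 2 ^ℚ (k′ ℕ.* B) * a′ ^ℚ (B ℕ.* B′) ≤ ι 2 ^ℚ (m′ ℕ.* B)
      p2 = subst₂ _≤_
        (trans (^ℚ-distrib-* (ι 2 ^ℚ k′) (a′ ^ℚ B′) B) (cong₂ _*_ (^ℚ-assoc (ι 2) k′ B)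
          (trans (^ℚ-assoc a′ B′ B) (cong (a′ ^ℚ_) (ℕ.*-comm B′ B)))))
        (^ℚ-assoc (ι 2) m′ B)
        (^-mono B (*nn (0≤2^ k′) (^-nn B′ (<⇒≤ (<-trans 0<a a<a′)))) h′)
      chain : ι 2 ^ℚ (m ℕ.* B′) * ι 2 ^ℚ (k′ ℕ.* B) * a ^ℚ (B ℕ.* B′) ≤
              ι 2 ^ℚ (k ℕ.* B′) * ι 2 ^ℚ (m′ ℕ.* B) * a ^ℚ (B ℕ.* B′)
      chain = ≤-trans
        (≤-reflexive (*-assoc (ι 2 ^ℚ (m ℕ.* B′)) (ι 2 ^ℚ (k′ ℕ.* B)) (a ^ℚ (B ℕ.* B′))))
        (≤-trans (*mono-≤ (0≤2^ (m ℕ.* B′)) (0≤2^ (m′ ℕ.* B)) p1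
            (≤-trans (*-monoˡ-≤-nonNeg (ι 2 ^ℚ (k′ ℕ.* B)) {{nonNegative (0≤2^ (k′ ℕ.* B))}} (^-mono (B ℕ.* B′) (<⇒≤ 0<a) (<⇒≤ a<a′))) p2))
          (≤-reflexive (solve 3 (λ x y z → x :* y :* z := x :* z :* y) refl (ι 2 ^ℚ (k ℕ.* B′)) (a ^ℚ (B ℕ.* B′)) (ι 2 ^ℚ (m′ ℕ.* B)))))

    power-gap : ∀ {a a′ m k} n → 0ℚ ≤ a′ → a′ ^ℚ n ≤ ι 2 * a ^ℚ n →
      ι 2 ^ℚ k * a ^ℚ n ≤ ι 2 ^ℚ m → ι 2 ^ℚ k * a′ ^ℚ n ≤ ι 2 ^ℚ suc m
    power-gap {a} {a′} {m} {k} n 0≤a′ h h′ = ≤-trans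
      (*-monoˡ-≤-nonNeg (ι 2 ^ℚ k) {{nonNegative (^-nn k (ι-nn 2))}} h)
      (subst (_≤ ι 2 ^ℚ suc m) (solve 2 (λ x y → con (ι 2) :* (x :* y) := x :* (con (ι 2) :* y)) refl (ι 2 ^ℚ k) (a ^ℚ n))
        (*-monoˡ-≤-nonNeg (ι 2) h′))

    2^-unbounded : ∀ z → ∃[ k ] z < ι 2 ^ℚ k
    2^-unbounded z = let n , z<n = archimedes z in n , <-≤-trans z<n (n≤2^n n)
      where
      n≤2^n : ∀ n → ι n ≤ ι 2 ^ℚ n
      n≤2^n zero = <⇒≤ 0<1
      n≤2^n (suc n) = subst₂ _≤_ (sym (ι-suc n)) (solve 1 (λ z → z :+ z := con (ι 2) :* z) refl (ι 2 ^ℚ n))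
        (+-mono-≤ (n≤2^n n) (1≤2^ n))

open Power-Lemmas

-- q < log₂ x  iff  q < r for some fraction r = (m - k)/(b + 1) with 2^r ≤ a < x
-- for a rational a, where 2^r ≤ a is expressed as 2^m ≤ 2^k a^(b+1).
record Log₂Lower (x : ℝ) (q : ℚ) : Set where
  constructor log₂-lower
  field
    {a} : ℚ
    m k b : ℕ
    0<a : 0ℚ < a
    a<x : lower x a
    power : ι 2 ^ℚ m ≤ ι 2 ^ℚ k * a ^ℚ suc b
    below-fraction : q * ι (suc b) < ι m - ι k

record Log₂Upper (x : ℝ) (q : ℚ) : Set where
  constructor log₂-upper
  field
    {a} : ℚ
    m k b : ℕ
    x<a : upper x a
    power : ι 2 ^ℚ k * a ^ℚ suc b ≤ ι 2 ^ℚ m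
    above-fraction : ι m - ι k < q * ι (suc b)

log₂ : (x : ℝ) {{_ : IsPositive x}} → ℝ
log₂ x .lower = Log₂Lower x
log₂ x .upper = Log₂Upper x
log₂ x {{is-positive {w} 0<w w<x}} .lower-inhabited =
  let v , 0<v , wv≡1 = solve-for w 1ℚ 0<w 0<1
      k , v<2^k = 2^-unbounded v in
  - ι k - 1ℚ , log₂-lower 0 k 0 0<w w<x
    (≤-trans (≤-reflexive (sym wv≡1)) (≤-trans (*-monoˡ-≤-nonNeg w {{nonNegative (<⇒≤ 0<w)}} (<⇒≤ v<2^k))
      (≤-reflexive (solve 2 (λ w p → w :* p := p :* (w :* con 1ℚ)) refl w (ι 2 ^ℚ k)))))
    (<by 1ℚ 0<1 (solve 1 (λ k → (:- k :- con 1ℚ) :* con (ι 1) :+ con 1ℚ := con 0ℚ :- k) refl (ι k)))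
log₂ x .upper-inhabited =
  let u , x<u = upper-inhabited x
      m , u<2^m = 2^-unbounded u in
  ι m + 1ℚ , log₂-upper m 0 0 x<u
    (≤-trans (≤-reflexive (solve 1 (λ u → con 1ℚ :* (u :* con 1ℚ) := u) refl u)) (<⇒≤ u<2^m))
    (<by 1ℚ 0<1 (solve 1 (λ m → m :- con 0ℚ :+ con 1ℚ := (m :+ con 1ℚ) :* con (ι 1)) refl (ι m)))
log₂ x .lower-closed p<q (log₂-lower m k b 0<a a<x h l) =
  log₂-lower m k b 0<a a<x h (<-trans (*mono-<ʳ (ι-pos (suc b)) p<q) l)
log₂ x .upper-closed p<q (log₂-upper m k b x<a h l) =
  log₂-upper m k b x<a h (<-trans l (*mono-<ʳ (ι-pos (suc b)) p<q))
log₂ x .lower-open (log₂-lower m k b 0<a a<x h l) = let r , q<r , l′ = slack-above (ι-pos (suc b)) l in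
  r , q<r , log₂-lower m k b 0<a a<x h l′
log₂ x .upper-open (log₂-upper m k b x<a h l) = let r , r<q , l′ = slack-below (ι-pos (suc b)) l in
  r , r<q , log₂-upper m k b x<a h l′
log₂ x .disjoint {q} (log₂-lower m k b 0<a a<x h l) (log₂-upper m′ k′ b′ x<a′ h′ l′) =
  frac-disjoint {q} {m} {k} {b} {m′} {k′} {b′} l l′
    (power-disjoint {m = m} {k} {b} {m′} {k′} {b′} 0<a (lower<upper x a<x x<a′) h h′)
log₂ x {{is-positive {w} 0<w w<x}} .located {q} {r} q<r =
  let m , k , b , l , l′ = fractions-between q<r
      δ , 0<δ , eq = solve-for (ι 2 * ι (suc b)) w (*pos (ι-pos 2) (ι-pos (suc b))) 0<w
  in decide m k b l l′ 0<δ eq (approximate x w<x (proj₂ (upper-inhabited x)) 0<δ)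
  where
  decide : ∀ m k b {u δ} → q * ι (suc b) < ι m - ι k → ι (suc m) - ι k < r * ι (suc b) →
    0ℚ < δ → ι 2 * ι (suc b) * δ ≡ w → Approximation x w u δ → Log₂Lower x q ⊎ Log₂Upper x r
  decide m k b {δ = δ} l l′ 0<δ eq (a , a′ , w≤a , _ , a<x , x<a′ , a′<) =
    [ (λ h → inj₂ (log₂-upper (suc m) k b x<a′ (power-gap {a} {a′} {m} {k} (suc b) (<⇒≤ 0<a′) close-powers (<⇒≤ h)) l′)) ,
      (λ h → inj₁ (log₂-lower m k b 0<a a<x h l)) ]′ (split (ι 2 ^ℚ k * a ^ℚ suc b) (ι 2 ^ℚ m))
    where
    0<a : 0ℚ < a
    0<a = <-≤-trans 0<w w≤a
    0<a′ : 0ℚ < a′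
    0<a′ = <-trans 0<a (lower<upper x a<x x<a′)
    close-powers : a′ ^ℚ suc b ≤ ι 2 * a ^ℚ suc b
    close-powers = ≤-trans (^-mono (suc b) (<⇒≤ 0<a′) (<⇒≤ a′<))
      (power-close {a} {δ} (suc b) 0<a (<⇒≤ 0<δ) (≤-trans (≤-reflexive (trans (sym (*-assoc (ι 2) (ι (suc b)) δ)) eq)) w≤a))

invFact : ℕ → ℚ
invFact n = (ℤ.+ 1 / n !) {{n ℕ.!≢0}}

expSum : ℕ → ℚ
expSum zero    = invFact 0
expSum (suc n) = expSum n + invFact (suc n)

module Exponential-Lemmas where
  abstract
    1/-inverse : ∀ d .{{_ : ℕ.NonZero d}} → ι d * (ℤ.+ 1 / d) ≡ 1ℚ
    1/-inverse d@(suc d-1) = toℚᵘ-injective (ℚᵘ.≃-trans (toℚᵘ-homo-* (ι d) (ℤ.+ 1 / d))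
      (ℚᵘ.≃-trans (ℚᵘ.*-cong (toℚᵘ-fromℚᵘ (ℚᵘ.mkℚᵘ (ℤ.+ d) 0)) (toℚᵘ-fromℚᵘ (ℚᵘ.mkℚᵘ (ℤ.+ 1) d-1)))
        (*≡* (trans (cong (ℤ._* ℤ.+ 1) (ℤ.*-identityʳ (ℤ.+ d))) (trans (ℤ.*-comm (ℤ.+ d) (ℤ.+ 1)) (cong (λ z → ℤ.+ 1 ℤ.* ℤ.+ z) (sym (ℕ.+-identityʳ d))))))))
      where import Data.Integer.Properties as ℤ

    invFact-pos : ∀ n → 0ℚ < invFact n
    invFact-pos n = positive⁻¹ (invFact n) {{normalize-pos 1 (n !) {{n ℕ.!≢0}}}}

    invFact-suc : ∀ n → ι (suc n) * invFact (suc n) ≡ invFact n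
    invFact-suc n = begin
      ι (suc n) * t′                     ≡⟨ *-identityˡ (ι (suc n) * t′) ⟨
      1ℚ * (ι (suc n) * t′)              ≡⟨ cong (_* (ι (suc n) * t′)) (1/-inverse (n !) {{n ℕ.!≢0}}) ⟨
      ι (n !) * t * (ι (suc n) * t′)     ≡⟨ solve 4 (λ f t s t′ → f :* t :* (s :* t′) := s :* f :* t′ :* t) refl (ι (n !)) t (ι (suc n)) t′ ⟩
      ι (suc n) * ι (n !) * t′ * t       ≡⟨ cong (λ z → z * t′ * t) (ι-homo-* (suc n) (n !)) ⟨
      ι (suc n !) * t′ * t               ≡⟨ cong (_* t) (1/-inverse (suc n !) {{suc n ℕ.!≢0}}) ⟩
      1ℚ * t                             ≡⟨ *-identityˡ t ⟩
      t                                  ∎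
      where
      open Eq.≡-Reasoning
      t t′ : ℚ
      t  = invFact n
      t′ = invFact (suc n)

    invFact≤1 : ∀ n → invFact n ≤ 1ℚ
    invFact≤1 zero = ≤-refl
    invFact≤1 (suc n) = ≤-trans (≤by (ι n * invFact (suc n)) (*nn (ι-nn n) (<⇒≤ (invFact-pos (suc n))))
      (trans (solve 2 (λ n t → t :+ n :* t := (n :+ con 1ℚ) :* t) refl (ι n) (invFact (suc n)))
        (trans (cong (_* invFact (suc n)) (sym (ι-suc n))) (invFact-suc n)))) (invFact≤1 n)

    expSum-mono : ∀ n d → expSum n ≤ expSum (d ℕ.+ n)
    expSum-mono n zero = ≤-refl
    expSum-mono n (suc d) = ≤-trans (expSum-mono n d) (≤by (invFact (suc (d ℕ.+ n))) (<⇒≤ (invFact-pos (suc (d ℕ.+ n)))) refl)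

    expTail-step : ∀ n → expSum (suc n) + ι 2 * invFact (suc (suc n)) ≤ expSum n + ι 2 * invFact (suc n)
    expTail-step n = ≤by (ι n * invFact (suc (suc n))) (*nn (ι-nn n) (<⇒≤ (invFact-pos (suc (suc n)))))
      (trans (solve 4 (λ s t n t′ → s :+ t :+ con (ι 2) :* t′ :+ n :* t′ := s :+ t :+ (n :+ con 1ℚ :+ con 1ℚ) :* t′) refl (expSum n) (invFact (suc n)) (ι n) (invFact (suc (suc n))))
      (trans (cong (λ z → expSum n + invFact (suc n) + z) (trans (cong (_* invFact (suc (suc n))) (sym (trans (ι-suc (suc n)) (cong (_+ 1ℚ) (ι-suc n))))) (invFact-suc (suc n))))
        (solve 2 (λ s t → s :+ t :+ t := s :+ con (ι 2) :* t) refl (expSum n) (invFact (suc n)))))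

    expTail-mono : ∀ n d → expSum (d ℕ.+ n) + ι 2 * invFact (suc (d ℕ.+ n)) ≤ expSum n + ι 2 * invFact (suc n)
    expTail-mono n zero = ≤-refl
    expTail-mono n (suc d) = ≤-trans (expTail-step (d ℕ.+ n)) (expTail-mono n d)

    expSum≤ : ∀ n → expSum n ≤ expSum n + ι 2 * invFact (suc n)
    expSum≤ n = ≤by (ι 2 * invFact (suc n)) (*nn (ι-nn 2) (<⇒≤ (invFact-pos (suc n)))) refl

    exp-bounds : ∀ m n → expSum m ≤ expSum n + ι 2 * invFact (suc n)
    exp-bounds m n with ℕ.≤-total m n
    ... | inj₁ m≤n = ≤-trans (subst (λ z → expSum m ≤ expSum z) (ℕ.m∸n+n≡m m≤n) (expSum-mono m (n ℕ.∸ m))) (expSum≤ n)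
    ... | inj₂ n≤m = ≤-trans (expSum≤ m)
      (subst (λ z → expSum z + ι 2 * invFact (suc z) ≤ expSum n + ι 2 * invFact (suc n)) (ℕ.m∸n+n≡m n≤m) (expTail-mono n (m ℕ.∸ n)))

    small-tail : ∀ {ε} → 0ℚ < ε → ∃[ n ] ι 2 * invFact (suc n) < ε
    small-tail {ε} 0<ε = let δ , 0<δ , eq = solve-for ε (ι 2) 0<ε (ι-pos 2)
                             n , δ<n = archimedes δ in
      n , subst₂ _<_ (trans (sym (*-assoc ε δ (invFact (suc n)))) (cong (_* invFact (suc n)) eq)) refl
        (<-≤-trans (*-monoʳ-<-pos ε {{positive 0<ε}} (*mono-<ʳ (invFact-pos (suc n)) (<-≤-trans δ<n (ι-mono (ℕ.n≤1+n n)))))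
          (subst (_≤ ε) (cong (ε *_) (sym (invFact-suc n))) (subst (ε * invFact n ≤_) (*-identityʳ ε)
            (*-monoˡ-≤-nonNeg ε {{nonNegative (<⇒≤ 0<ε)}} (invFact≤1 n)))))

    exp-gap : ∀ {s t q r} → s ≤ q → t < r - q → s + t < r
    exp-gap {s} {t} {q} {r} s≤q t< = <by ((q - s) + (r - q - t)) (+-mono-≤-< (sub-nn s≤q) (sub-pos t<))
      (solve 4 (λ s t q r → s :+ t :+ (q :- s :+ (r :- q :- t)) := r) refl s t q r)

open Exponential-Lemmas

-- e = Σ 1/k!, with the tail estimate Σ_{k > n} 1/k! < 2/(n+1)!.
e : ℝ
e .lower q = ∃[ n ] q < expSum n
e .upper q = ∃[ n ] expSum n + ι 2 * invFact (suc n) < q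
e .lower-inhabited = expSum 0 - 1ℚ , 0 , -1< (expSum 0)
e .upper-inhabited = expSum 0 + ι 2 * invFact 1 + 1ℚ , 0 , <by 1ℚ 0<1 refl
e .lower-closed p<q (n , h) = n , <-trans p<q h
e .upper-closed p<q (n , h) = n , <-trans h p<q
e .lower-open (n , h) = let m , q<m , h′ = <-dense h in m , q<m , n , h′
e .upper-open (n , h) = let m , h′ , m<q = <-dense h in m , m<q , n , h′
e .disjoint (m , h) (n , h′) = <-irrefl refl (<-trans h (≤-<-trans (exp-bounds m n) h′))
e .located {q} {r} q<r = let n , tail<r-q = small-tail (sub-pos q<r) in
  [ (λ q< → inj₁ (n , q<)) , (λ ≤q → inj₂ (n , exp-gap {expSum n} {ι 2 * invFact (suc n)} ≤q tail<r-q)) ]′ (split q (expSum n))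

instance
  fromℕ-positive : ∀ {n} .{{_ : ℕ.NonZero n}} → IsPositive (fromℕ n)
  fromℕ-positive {n} = let _ , 0<m , m<n = <-dense (ι-pos n) in is-positive 0<m m<n

  e-positive : IsPositive e
  e-positive = is-positive 0<½ (0 , *<* (ℤ.+<+ (ℕ.s≤s (ℕ.s≤s ℕ.z≤n))))

  *-positive : ∀ {x y} {{_ : IsPositive x}} {{_ : IsPositive y}} → IsPositive (x *ℝ y)
  *-positive {x} {y} {{is-positive {a} 0<a a<x}} {{is-positive {c} 0<c c<y}} =
    let _ , x<b = upper-inhabited x ; _ , y<d = upper-inhabited y ; _ , 0<q , q<ac = <-dense (*pos 0<a 0<c) in
    is-positive 0<q (⟨ a<x , x<b , c<y , y<d ⟩ , a * c , q<ac , λ e f ((a≤e , _) , (c≤f , _)) →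
      *mono-≤ (<⇒≤ 0<a) (<⇒≤ (<-≤-trans 0<c c≤f)) a≤e c≤f)

  ⁻¹-positive : ∀ {x} {{_ : IsPositive x}} → IsPositive (x ⁻¹)
  ⁻¹-positive {x} = let u , x<u = upper-inhabited x ; δ , 0<δ , eq = solve-for u ½ (pos-upper x x<u) 0<½ in
    is-positive 0<δ (u , x<u , subst (_< 1ℚ) (trans (sym eq) (*-comm u δ)) ½<1)
    where
    ½<1 : ½ < 1ℚ
    ½<1 = *<* (ℤ.+<+ (ℕ.s≤s (ℕ.s≤s ℕ.z≤n)))

  √-positive : ∀ {x} {{_ : IsPositive x}} → IsPositive (√ x)
  √-positive {x} {{is-positive {p} 0<p p<x}} with ≤-total p 1ℚ
  ... | inj₁ p≤1 = let m , 0<m , m<p = <-dense 0<p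
                       q , 0<q , q<m = <-dense 0<m in
        is-positive 0<q (m , q<m , inj₂ (lower-closed x (<-≤-trans (*mono-< 0<m 0<m m<p m<p)
          (≤-trans (*-monoˡ-≤-nonNeg p {{nonNegative (<⇒≤ 0<p)}} p≤1) (≤-reflexive (*-identityʳ p)))) p<x))
  ... | inj₂ 1≤p = let m , 0<m , m<1 = <-dense 0<1
                       q , 0<q , q<m = <-dense 0<m in
        is-positive 0<q (m , q<m , inj₂ (lower-closed x (<-≤-trans (*mono-< 0<m 0<m m<1 m<1)
          (≤-trans (≤-reflexive (*-identityʳ 1ℚ)) 1≤p)) p<x))

IsCeiling : ℕ → ℝ → Set
IsCeiling m x = (x ≤ℝ fromℕ m) × (fromℕ m <ℝ x +ℝ 1ℝ)

-- Only the underlying set of 𝔽₂ⁿ matters here.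
Point : ℕ → Set
Point n = Vec Bool n

-- A subset is given by its membership oracle.
Subset : ℕ → Set
Subset n = Point n → Bool

allPoints : ∀ n → List (Point n)
allPoints zero    = [] ∷ []
allPoints (suc n) = map (false ∷_) (allPoints n) ++ map (true ∷_) (allPoints n)

elements : ∀ {n} → Subset n → List (Point n)
elements {n} S = filterᵇ S (allPoints n)

card : ∀ {n} → Subset n → ℕ
card S = length (elements S)

-- Deterministic algorithms with a membership oracle.
data Query (n : ℕ) (A : Set) : Set where
  return : A → Query n A
  ask    : Point n → (Bool → Query n A) → Query n A

evaluate : ∀ {n A} → Subset n → Query n A → A
evaluate S (return a) = a
evaluate S (ask x k)  = evaluate S (k (S x))

queryCount : ∀ {n A} → Subset n → Query n A → ℕ
queryCount S (return a) = 0
queryCount S (ask x k)  = suc (queryCount S (k (S x)))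

-- Randomised algorithms with a membership oracle for S and fresh independent
-- uniform samples from S.
data Program (n : ℕ) (A : Set) : Set where
  return : A → Program n A
  ask    : Point n → (Bool → Program n A) → Program n A
  sample : (Point n → Program n A) → Program n A

infixl 1 _>>=_

_>>=_ : ∀ {n A B} → Program n A → (A → Program n B) → Program n B
return a >>= f = f a
ask x k  >>= f = ask x (λ b → k b >>= f)
sample k >>= f = sample (λ x → k x >>= f)

deterministic : ∀ {n A} → Query n A → Program n A
deterministic (return a) = return a
deterministic (ask x k)  = ask x (λ b → deterministic (k b))

-- The probability that the output satisfies E.
Pr : ∀ {n A} (S : Subset n) .{{_ : ℕ.NonZero (card S)}} → Program n A → (A → Bool) → ℚ
Pr S (return a) E = if E a then 1ℚ else 0ℚ
Pr S (ask x k)  E = Pr S (k (S x)) E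
Pr S (sample k) E = (ℤ.+ 1 / card S) * foldr _+_ 0ℚ (map (λ x → Pr S (k x) E) (elements S))

Pr[_∣_] : ∀ {n A} → (A → Bool) → (F : A → Bool) (S : Subset n) .{{_ : ℕ.NonZero (card S)}}
  (P : Program n A) .{{_ : NonZero (Pr S P F)}} → ℚ
Pr[ E ∣ F ] S P = Pr S P (λ a → E a ∧ F a) ÷ Pr S P F

-- Worst case over all outcomes of the samples.
maxSamples : ∀ {n A} → Subset n → Program n A → ℕ
maxSamples S (return a) = 0
maxSamples S (ask x k)  = maxSamples S (k (S x))
maxSamples S (sample k) = suc (foldr ℕ._⊔_ 0 (map (λ x → maxSamples S (k x)) (elements S)))

maxQueries : ∀ {n A} → Subset n → Program n A → ℕ
maxQueries S (return a) = 0
maxQueries S (ask x k)  = suc (maxQueries S (k (S x)))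
maxQueries S (sample k) = foldr ℕ._⊔_ 0 (map (λ x → maxQueries S (k x)) (elements S))

uniform : ∀ {n} (Y : Subset n) .{{_ : ℕ.NonZero (card Y)}} → Point n → ℚ
uniform Y x = if Y x then ℤ.+ 1 / card Y else 0ℚ

uniform^⊗ : ∀ {n t} (Y : Subset n) .{{_ : ℕ.NonZero (card Y)}} → Vec (Point n) t → ℚ
uniform^⊗ Y []       = 1ℚ
uniform^⊗ Y (y ∷ ys) = uniform Y y * uniform^⊗ Y ys

-- Opaque so that instance search does not try to see it as some fromℕ n.
opaque
  cBSG : ℝ
  cBSG = fromℚ (ℤ.+ 21 / 128)

  cBSG≡21/128 : cBSG ≡ fromℚ (ℤ.+ 21 / 128)
  cBSG≡21/128 = refl

instance
  cBSG-positive : IsPositive cBSG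
  cBSG-positive = let _ , 0<m , m<c = <-dense {0ℚ} {ℤ.+ 21 / 128} (*<* (ℤ.+<+ (ℕ.s≤s ℕ.z≤n))) in
    subst IsPositive (sym cBSG≡21/128) (is-positive 0<m m<c)

Λ : ℕ → (α ρsnd ρcmp : ℝ) {{_ : IsPositive α}} {{_ : IsPositive ρsnd}} {{_ : IsPositive ρcmp}} → ℝ
Λ n α ρsnd ρcmp = 1ℝ +ℝ fromℕ n +ℝ log₂ (α ⁻¹) +ℝ log₂ (ρsnd ⁻¹) +ℝ log₂ (ρcmp ⁻¹)

-- A nonfailure record, through the properties that are available of it.
-- K is the constant implied in the O(α⁻⁴ Λ³) cost of one evaluation.
record NonfailureRecord (K : ℕ) {n : ℕ} (S : Subset n) (α ρsnd ρcmp : ℝ)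
  {{_ : IsPositive α}} {{_ : IsPositive ρsnd}} {{_ : IsPositive ρcmp}} : Set where
  field
    member : Point n → Query n Bool

  Y : Subset n
  Y x = evaluate S (member x)

  field
    Y⊆S         : ∀ x → T (Y x) → T (S x)
    member-cost : ∀ x → fromℕ (queryCount S (member x)) ≤ℝ
                        fromℕ K *ℝ (α ⁻¹) ^ℝ 4 *ℝ Λ n α ρsnd ρcmp ^ℝ 3

drawBlock : ∀ {n} T → Program n (Vec (Point n) T)
drawBlock zero    = return []
drawBlock (suc T) = do
  x  ← sample return
  xs ← drawBlock T
  return (x ∷ xs)

firstAccepted : ∀ {n T} → (Point n → Query n Bool) → Vec (Point n) T → Program n (Maybe (Point n))
firstAccepted member []       = return nothing
firstAccepted member (x ∷ xs) = do
  accepted ← deterministic (member x)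
  if accepted then return (just x) else firstAccepted member xs

-- `nothing` is FAIL.
sampleTuple : ∀ {n} → (Point n → Query n Bool) → (t T : ℕ) → Program n (Maybe (Vec (Point n) t))
sampleTuple member zero    T = return (just [])
sampleTuple member (suc t) T = do
  block  ← drawBlock T
  just y ← firstAccepted member block
    where nothing → return nothing
  just ys ← sampleTuple member t T
    where nothing → return nothing
  return (just (y ∷ ys))

_isOutput_ : ∀ {n t} → Vec (Point n) t → Maybe (Vec (Point n) t) → Bool
v isOutput r = does (Maybe.≡-dec (Vec.≡-dec (Vec.≡-dec Bool._≟_)) r (just v))

{-# OPTIONS --safe #-}
module Submission where

-- Put w = 1 - |Y|/|S|.  A block outputs a uniform point of Y with probability 1 - w^T and is exhausted
-- with probability w^T, so the law of the tuple and the union bound t w^T are computed block by block.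
-- From w^|S| ≤ 2^(-|Y|) and |Y| ≥ c √α |S| one gets t w^T ≤ ρ; over the Dedekind reals this is shown by
-- refuting u < t w^T for every rational u > ρ.  The query count is at most t T M with M a common bound
-- for one evaluation, and T ≤ 7 (√α)⁻¹ log (e t / ρ) because 1/c < 7 and e ≥ 2 absorbs the ceiling.

open import Defs
import Data.Bool.Properties as Bool
import Data.Integer.Base as ℤ
import Data.Nat.Base as ℕ
import Data.Nat.Properties as ℕ
import Data.Vec.Properties as Vec
open import Relation.Nullary.Decidable using (toWitness)

-- Order on `ℝ` is inclusion of lower cuts, so every claim is moved to ℚ: `fromℚ p ≤ℝ y` amounts to
-- p being at most each rational above y, and a product of reals is reached through rational bounds
-- of its factors. The order of ℚ is decidable, so the resulting inequalities may be proved by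
-- contradiction. Cuts are open, so each passage needs a strict margin; hence the many intermediate
-- rationals, and K + 1 in the final constant 7 (K + 1).
--
-- The estimate w^|S| ≤ 2^(-|Y|) uses d = 1/|S| and two facts: (1 + d)^|S| ≥ 2 by Bernoulli, and (1
-- - |Y| d)(1 + d)^|Y| ≤ 1. No power with a real exponent appears, because membership in the cut of
-- a logarithm is a comparison of integer powers: a violated failure bound is amplified until it
-- becomes such a comparison.

module Notation where
  open import Data.Bool public using (Bool; true; false; if_then_else_; _∧_; T)
  open import Data.Empty public using (⊥; ⊥-elim)
  open import Data.List.Base public using (List; []; _∷_; _++_; length; map; filterᵇ; foldr)
  open import Data.Maybe.Base public using (Maybe; just; nothing; is-just; is-nothing)
  open import Data.Nat.Base public using (ℕ; zero; suc)
  open import Data.Product public using (Σ-syntax; ∃-syntax; _×_; _,_; proj₁; proj₂)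
  open import Data.Rational.Base public hiding (+-rawMonoid; *-rawMonoid)
  open import Data.Rational.Properties public
  open import Data.Rational.Solver using (module +-*-Solver)
  open import Data.Sum.Base public using (_⊎_; inj₁; inj₂; [_,_]′)
  open import Data.Vec.Base public using (Vec; []; _∷_)
  open import Relation.Binary.PropositionalEquality public
    using (_≡_; refl; sym; trans; cong; cong₂; subst; subst₂; module ≡-Reasoning)
  open import Relation.Nullary public using (¬_; does)
  open +-*-Solver public using (solve; _:+_; _:*_; _:-_; :-_; _:=_; con)
  open ℝ public
  open Rational-Lemmas public
  open Reciprocal-Lemmas public
  open Power-Lemmas public
  open Exponential-Lemmas public using (1/-inverse)
  open Box-Lemmas public using (⟨_,_,_,_⟩)

-- Order, products, powers, roots and logarithms of cuts through rational bounds.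

module Cuts where
  open Notation

  -- Locatedness decides between q and a slightly larger m < p; the answer y < m would contradict
  -- the hypothesis at m.
  fromℚ-≤ℝ : ∀ {p} y → (∀ {u} → upper y u → p ≤ u) → fromℚ p ≤ℝ y
  fromℚ-≤ℝ y h q<p with <-dense q<p
  ... | m , q<m , m<p with located y q<m
  ...   | inj₁ q<y = q<y
  ...   | inj₂ y<m = ⊥-elim (<-irrefl refl (<-≤-trans m<p (h y<m)))

  fromℚ-≤-upper : ∀ {p} y {u} → fromℚ p ≤ℝ y → upper y u → p ≤ u
  fromℚ-≤-upper y p≤y y<u = ≮⇒≥ λ u<p → disjoint y (p≤y u<p) y<u

  upper-⊓ : ∀ x {u v} → upper x u → upper x v → upper x (u ⊓ v)
  upper-⊓ x {u} {v} x<u x<v with ⊓-sel u v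
  ... | inj₁ eq = subst (upper x) (sym eq) x<u
  ... | inj₂ eq = subst (upper x) (sym eq) x<v

  -- The corner (b , d) lies in every box, whatever the signs, so the bound over the box applies to
  -- b d.
  *-upper⁻ : ∀ x y {q} → upper (x *ℝ y) q → ∃[ b ] ∃[ d ] upper x b × upper y d × b * d < q
  *-upper⁻ x y (B , p , p<q , h) = b , d , x<b , y<d ,
    ≤-<-trans (h b d ((<⇒≤ (lower<upper x a<x x<b) , ≤-refl) , (<⇒≤ (lower<upper y c<y y<d) , ≤-refl))) p<q
    where open Box B

  -- Nothing is known about the left edge of the box for x, so e may be negative. Keeping f ≥ w > 0
  -- and b ≥ 0 still gives e f ≤ b f ≤ b d.
  *-upper⁺ : ∀ x y {{_ : IsPositive y}} {b d q} → 0ℚ ≤ b → upper x b → upper y d → b * d < q → upper (x *ℝ y) q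
  *-upper⁺ x y {{is-positive {w} 0<w w<y}} {b} {d} 0≤b x<b y<d bd<q =
    ⟨ proj₂ (lower-inhabited x) , x<b , w<y , y<d ⟩ , b * d , bd<q , λ e f ((_ , e≤b) , (w≤f , f≤d)) →
      ≤-trans (*-monoʳ-≤-nonNeg f {{nonNegative (≤-trans (<⇒≤ 0<w) w≤f)}} e≤b)
              (*-monoˡ-≤-nonNeg b {{nonNegative 0≤b}} f≤d)

  *-lower⁺ : ∀ x y {a c q} → 0ℚ ≤ a → 0ℚ ≤ c → lower x a → lower y c → q < a * c → lower (x *ℝ y) q
  *-lower⁺ x y {a} {c} 0≤a 0≤c a<x c<y q<ac =
    ⟨ a<x , proj₂ (upper-inhabited x) , c<y , proj₂ (upper-inhabited y) ⟩ , a * c , q<ac ,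
    λ e f ((a≤e , _) , (c≤f , _)) → *mono-≤ 0≤a (≤-trans 0≤c c≤f) a≤e c≤f

  ^-positive : ∀ x {{_ : IsPositive x}} n → IsPositive (x ^ℝ n)
  ^-positive x zero    = let _ , 0<m , m<1 = <-dense 0<1 in is-positive 0<m m<1
  ^-positive x {{x>0}} (suc n) = *-positive {x} {x ^ℝ n} {{x>0}} {{^-positive x n}}

  -- Opening the product gives a different bound of x for each factor; their minimum is again a
  -- bound and serves as the common base.
  ^-upper⁻ : ∀ x {{_ : IsPositive x}} n {q} → upper (x ^ℝ n) q → ∃[ b ] upper x b × b ^ℚ n ≤ q
  ^-upper⁻ x zero    1<q = let u , x<u = upper-inhabited x in u , x<u , <⇒≤ 1<q
  ^-upper⁻ x (suc n) h =
    let b , d , x<b , xⁿ<d , bd<q = *-upper⁻ x (x ^ℝ n) h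
        c , x<c , cⁿ≤d = ^-upper⁻ x n xⁿ<d
        x<m = upper-⊓ x x<b x<c
        0≤m = <⇒≤ (pos-upper x x<m)
        mⁿ≤d = ≤-trans (^-mono n 0≤m (p⊓q≤q b c)) cⁿ≤d
    in b ⊓ c , x<m , ≤-trans (*mono-≤ 0≤m (≤-trans (^-nn n 0≤m) mⁿ≤d) (p⊓q≤p b c) mⁿ≤d) (<⇒≤ bd<q)

  ^-upper⁺ : ∀ x {{_ : IsPositive x}} n {b q} → upper x b → b ^ℚ n < q → upper (x ^ℝ n) q
  ^-upper⁺ x zero    x<b bⁿ<q = bⁿ<q
  ^-upper⁺ x (suc n) {b} {q} x<b bⁿ<q =
    let 0<b = pos-upper x x<b
        d , bⁿ<d , db<q = slack-above {b ^ℚ n} 0<b (subst (_< q) (*-comm b (b ^ℚ n)) bⁿ<q)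
    in *-upper⁺ x (x ^ℝ n) {{^-positive x n}} (<⇒≤ 0<b) x<b (^-upper⁺ x n x<b bⁿ<d) (subst (_< q) (*-comm d b) db<q)

  -- The hypothesis 0 ≤ y puts only negative rationals below y. One of them, v - w, is paid for by
  -- the witness w of x, leaving w + (v - w) = v > 0.
  +-positive : ∀ x y {{_ : IsPositive x}} → 0ℝ ≤ℝ y → IsPositive (x +ℝ y)
  +-positive x y {{is-positive {w} 0<w w<x}} 0≤y with <-dense 0<w
  ... | v , 0<v , v<w with <-dense 0<v
  ...   | u , 0<u , u<v = is-positive 0<u (w , v - w , w<x ,
            0≤y (<by (w - v) (sub-pos v<w) (solve 2 (λ v w → v :- w :+ (w :- v) := con 0ℚ) refl v w)) ,
            subst (u <_) (solve 2 (λ v w → v := w :+ (v :- w)) refl v w) u<v)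

  IsPositive⇒0≤ℝ : ∀ x {{_ : IsPositive x}} → 0ℝ ≤ℝ x
  IsPositive⇒0≤ℝ x {{is-positive 0<w w<x}} q<0 = lower-closed x (<-trans q<0 0<w) w<x

  bernoulli-1+ : ∀ {δ} n → 0ℚ ≤ δ → 1ℚ + ι n * δ ≤ (1ℚ + δ) ^ℚ n
  bernoulli-1+ {δ} zero    0≤δ = ≤-reflexive (solve 1 (λ δ → con 1ℚ :+ con 0ℚ :* δ := con 1ℚ) refl δ)
  bernoulli-1+ {δ} (suc n) 0≤δ = ≤-trans
    (≤by (ι n * (δ * δ)) (*nn (ι-nn n) (*nn 0≤δ 0≤δ)) (trans (cong (λ k → 1ℚ + k * δ + ι n * (δ * δ)) (ι-suc n))
      (solve 2 (λ k δ → con 1ℚ :+ (k :+ con 1ℚ) :* δ :+ k :* (δ :* δ) := (con 1ℚ :+ δ) :* (con 1ℚ :+ k :* δ)) refl (ι n) δ)))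
    (*-monoˡ-≤-nonNeg (1ℚ + δ) {{nonNegative (+nn (<⇒≤ 0<1) 0≤δ)}} (bernoulli-1+ n 0≤δ))

  -- With b + 1 > 1/(a - 1), Bernoulli gives a^(b+1) ≥ 1 + (b + 1)(a - 1) ≥ 2. This is the
  -- amplification used wherever a bare excess over 1 must become a factor 2.
  power-doubles : ∀ {a} → 1ℚ < a → ∃[ b ] ι 2 ≤ a ^ℚ suc b
  power-doubles {a} 1<a =
    let c , 0<c , eq = solve-for (a - 1ℚ) 1ℚ (sub-pos 1<a) 0<1
        b , c<b = archimedes c
        δ = a - 1ℚ
        0<δ = sub-pos 1<a
        c<sb = <-≤-trans c<b (ι-mono (ℕ.n≤1+n b))
    in b , ≤-trans (+-monoʳ-≤ 1ℚ (<⇒≤ (subst (_< ι (suc b) * δ) (trans (*-comm c δ) eq) (*mono-<ʳ 0<δ c<sb))))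
      (subst (λ z → 1ℚ + ι (suc b) * δ ≤ z ^ℚ suc b) (solve 1 (λ a → con 1ℚ :+ (a :- con 1ℚ) := a) refl a)
        (bernoulli-1+ (suc b) (<⇒≤ 0<δ)))

  -- From 2 ≤ a^(b+1) the fraction 1/(b + 1) is a lower bound for the logarithm of a, so m = 1 and k
  -- = 0 certify any q below it.
  log₂-positive : ∀ x {{_ : IsPositive x}} → 1ℝ <ℝ x → IsPositive (log₂ x)
  log₂-positive x (a , 1<a , a<x) =
    let b , 2≤aᵇ = power-doubles 1<a
        q , 0<q , qb<1 = slack-above {0ℚ} {ι (suc b)} {1ℚ} (ι-pos (suc b)) (subst (_< 1ℚ) (sym (*-zeroˡ (ι (suc b)))) 0<1)
    in is-positive 0<q (log₂-lower 1 0 b (<-trans 0<1 1<a) a<x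
         (≤-trans 2≤aᵇ (≤-reflexive (sym (*-identityˡ (a ^ℚ suc b))))) qb<1)

  1<⁻¹ : ∀ x {{_ : IsPositive x}} → x <ℝ 1ℝ → 1ℝ <ℝ x ⁻¹
  1<⁻¹ x (r , x<r , r<1) =
    let q , 1<q , qr<1 = slack-above {1ℚ} (pos-upper x x<r) (subst (_< 1ℚ) (sym (*-identityˡ r)) r<1)
    in q , 1<q , (r , x<r , qr<1)

  1<ℕ* : ∀ t {{_ : ℕ.NonZero t}} x → 1ℝ <ℝ x → 1ℝ <ℝ fromℕ t *ℝ x
  1<ℕ* t x (q , 1<q , q<x) =
    let 0<q = <-trans 0<1 1<q
        -- The lower cut of `fromℕ t` omits t itself, and t may be 1, so a factor just below 1 is
        -- needed.
        m , m<1 , 1<mq = slack-below {1ℚ} 0<q (subst (1ℚ <_) (sym (*-identityˡ q)) 1<q)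
        r , 1<r , r<mq = <-dense 1<mq
        0<m = *-cancelʳ-<-nonNeg q {{nonNegative (<⇒≤ 0<q)}} (subst (_< m * q) (sym (*-zeroˡ q)) (<-trans 0<1 1<mq))
    in r , 1<r , *-lower⁺ (fromℕ t) x (<⇒≤ 0<m) (<⇒≤ 0<q)
         (<-≤-trans m<1 (ι-mono {1} {t} (ℕ.>-nonZero⁻¹ t))) q<x r<mq

  -- A positive r below √ x comes with r′ > r and r′² < x, and squaring 1 < s r′ gives 1 < s² r′².
  -- The alternative r′ ≤ 0 in the definition of the root contradicts 0 < r < r′.
  √⁻¹-upper-square : ∀ x {{_ : IsPositive x}} {s} → upper ((√ x) ⁻¹) s → upper (x ⁻¹) (s * s)
  √⁻¹-upper-square x (r , 0<r , (r′ , r<r′ , inj₁ r′≤0) , _) = ⊥-elim (<-irrefl refl (<-≤-trans (<-trans 0<r r<r′) r′≤0))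
  √⁻¹-upper-square x {s} h@(r , 0<r , (r′ , r<r′ , inj₂ r′²<x) , 1<sr) =
    r′ * r′ , *pos 0<r′ 0<r′ , r′²<x ,
    subst (1ℚ <_) (solve 2 (λ s r → s :* r :* (s :* r) := s :* s :* (r :* r)) refl s r′) (*mono-< 0<1 0<1 1<sr′ 1<sr′)
    where
    0<r′ : 0ℚ < r′
    0<r′ = <-trans 0<r r<r′
    1<sr′ : 1ℚ < s * r′
    1<sr′ = <-trans 1<sr (*-monoʳ-<-pos s {{positive (pos-upper ((√ x) ⁻¹) {s} h)}} r<r′)

-- The failure bound t (1 - p)^T ≤ ρ in rational form.

module Failure where
  open Notation
  open Cuts

  ^-≤1 : ∀ {a} n → 0ℚ ≤ a → a ≤ 1ℚ → a ^ℚ n ≤ 1ℚ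
  ^-≤1 zero    0≤a a≤1 = ≤-refl
  ^-≤1 (suc n) 0≤a a≤1 = *mono-≤ 0≤a (<⇒≤ 0<1) a≤1 (^-≤1 n 0≤a a≤1)

  -- A rational stand-in for 1 - y d ≤ exp(-y d). In the inductive step, (1 - (y + 1) d)(1 + d)
  -- falls short of 1 - y d by (y + 1) d².
  decay : ∀ {d} y → 0ℚ ≤ d → (1ℚ - ι y * d) * (1ℚ + d) ^ℚ y ≤ 1ℚ
  decay {d} zero    0≤d = ≤-reflexive (solve 1 (λ d → (con 1ℚ :- con 0ℚ :* d) :* con 1ℚ := con 1ℚ) refl d)
  decay {d} (suc y) 0≤d = ≤-trans
    (≤by (P * (ι y * (d * d) + d * d)) (*nn (^-nn y (+nn (<⇒≤ 0<1) 0≤d)) (+nn (*nn (ι-nn y) (*nn 0≤d 0≤d)) (*nn 0≤d 0≤d)))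
      (trans (cong (λ k → (1ℚ - k * d) * ((1ℚ + d) * P) + P * (ι y * (d * d) + d * d)) (ι-suc y))
        (solve 3 (λ k d p → (con 1ℚ :- (k :+ con 1ℚ) :* d) :* ((con 1ℚ :+ d) :* p) :+ p :* (k :* (d :* d) :+ d :* d) :=
                            (con 1ℚ :- k :* d) :* p) refl (ι y) d P)))
    (decay y 0≤d)
    where
    P : ℚ
    P = (1ℚ + d) ^ℚ y

  -- (1 - p)^s ≤ 2^(-y) for p = y/s, where d = 1/s.
  reject-power : ∀ s y {d} → ι s * d ≡ 1ℚ → 0ℚ ≤ d → 0ℚ ≤ 1ℚ - ι y * d → (1ℚ - ι y * d) ^ℚ s * ι 2 ^ℚ y ≤ 1ℚ
  reject-power s y {d} sd≡1 0≤d 0≤w = ≤-trans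
    (*-monoˡ-≤-nonNeg (w ^ℚ s) {{nonNegative (^-nn s 0≤w)}} (≤-trans (^-mono y (ι-nn 2) 2≤) (≤-reflexive swap)))
    (≤-trans (≤-reflexive (sym (^ℚ-distrib-* w ((1ℚ + d) ^ℚ y) s)))
      (^-≤1 s (*nn 0≤w (^-nn y (+nn (<⇒≤ 0<1) 0≤d))) (decay y 0≤d)))
    where
    w : ℚ
    w = 1ℚ - ι y * d
    2≤ : ι 2 ≤ (1ℚ + d) ^ℚ s
    2≤ = subst (_≤ (1ℚ + d) ^ℚ s) (cong (1ℚ +_) sd≡1) (bernoulli-1+ s 0≤d)
    swap : ((1ℚ + d) ^ℚ s) ^ℚ y ≡ ((1ℚ + d) ^ℚ y) ^ℚ s
    swap = trans (^ℚ-assoc (1ℚ + d) s y) (trans (cong ((1ℚ + d) ^ℚ_) (ℕ.*-comm s y)) (sym (^ℚ-assoc (1ℚ + d) y s)))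

  -- Some power N raises z = a w^T to at least 2. The further exponent s exposes w^s ≤ 2^(-y), and
  -- the result is 2^(y T N + 1) ≤ a^(N s), the kind of comparison that certifies a lower bound of a
  -- logarithm.
  reject-power-log : ∀ s {{_ : ℕ.NonZero s}} y T {a d} → ι s * d ≡ 1ℚ → 0ℚ ≤ d → 0ℚ ≤ 1ℚ - ι y * d → 0ℚ ≤ a →
    1ℚ < a * (1ℚ - ι y * d) ^ℚ T →
    ∃[ m ] ∃[ b ] ι 2 ^ℚ m ≤ a ^ℚ suc b × ι y * d * ι T * ι (suc b) < ι m
  reject-power-log s y T {a} {d} sd≡1 0≤d 0≤w 0≤a 1<z = let b , 2≤zᴺ = power-doubles 1<z in scaled (suc b) 2≤zᴺ
    where
    w z : ℚ
    w = 1ℚ - ι y * d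
    z = a * w ^ℚ T
    scaled : ∀ N {{_ : ℕ.NonZero N}} → ι 2 ≤ z ^ℚ N →
      ∃[ m ] ∃[ b ] ι 2 ^ℚ m ≤ a ^ℚ suc b × ι y * d * ι T * ι (suc b) < ι m
    scaled N 2≤zᴺ = suc E , ℕ.pred B ,
      subst (λ k → ι 2 ^ℚ suc E ≤ a ^ℚ k) B≡suc bound , subst (λ k → ι y * d * ι T * ι k < ι (suc E)) B≡suc fraction
      where
      -- B is a multiple of s so that, with p = y d, the product p T B is exactly the integer E. The
      -- factor 2 contributed by z makes the exponent E + 1 and the inequality strict.
      B E : ℕ
      B = N ℕ.* s
      E = y ℕ.* (T ℕ.* N)
      B≡suc : B ≡ suc (ℕ.pred B)
      B≡suc = sym (ℕ.suc-pred B {{ℕ.m*n≢0 N s}})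
      2≤zᴮ : ι 2 ≤ z ^ℚ B
      2≤zᴮ = ≤-trans (≤-reflexive (sym (*-identityʳ (ι 2)))) (≤-trans (2^-mono-≤ (ℕ.>-nonZero⁻¹ s))
        (≤-trans (^-mono s (ι-nn 2) 2≤zᴺ) (≤-reflexive (^ℚ-assoc z N s))))
      small : w ^ℚ (T ℕ.* B) * ι 2 ^ℚ E ≤ 1ℚ
      small = subst (_≤ 1ℚ)
        (trans (^ℚ-distrib-* (w ^ℚ s) (ι 2 ^ℚ y) (T ℕ.* N)) (cong₂ _*_
          (trans (^ℚ-assoc w s (T ℕ.* N)) (cong (w ^ℚ_) (trans (ℕ.*-comm s (T ℕ.* N)) (ℕ.*-assoc T N s))))
          (^ℚ-assoc (ι 2) y (T ℕ.* N))))
        (^-≤1 (T ℕ.* N) (*nn (^-nn s 0≤w) (^-nn y (ι-nn 2))) (reject-power s y sd≡1 0≤d 0≤w))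
      bound : ι 2 ^ℚ suc E ≤ a ^ℚ B
      bound = ≤-trans (*-monoʳ-≤-nonNeg (ι 2 ^ℚ E) {{nonNegative (^-nn E (ι-nn 2))}} 2≤zᴮ)
        (≤-trans (≤-reflexive (trans (cong (_* ι 2 ^ℚ E) (trans (^ℚ-distrib-* a (w ^ℚ T) B)
            (cong (a ^ℚ B *_) (^ℚ-assoc w T B))))
            (*-assoc (a ^ℚ B) (w ^ℚ (T ℕ.* B)) (ι 2 ^ℚ E))))
          (≤-trans (*-monoˡ-≤-nonNeg (a ^ℚ B) {{nonNegative (^-nn B 0≤a)}} small)
            (≤-reflexive (*-identityʳ (a ^ℚ B)))))
      fraction : ι y * d * ι T * ι B < ι (suc E)
      fraction = <by 1ℚ 0<1 (trans (cong (_+ 1ℚ) (begin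
        ι y * d * ι T * ι B            ≡⟨ cong (ι y * d * ι T *_) (ι-homo-* N s) ⟩
        ι y * d * ι T * (ι N * ι s)    ≡⟨ solve 5 (λ y d t n s → y :* d :* t :* (n :* s) := y :* (t :* n) :* (s :* d)) refl (ι y) d (ι T) (ι N) (ι s) ⟩
        ι y * (ι T * ι N) * (ι s * d)  ≡⟨ cong₂ _*_ (trans (cong (ι y *_) (sym (ι-homo-* T N))) (sym (ι-homo-* y (T ℕ.* N)))) sd≡1 ⟩
        ι E * 1ℚ                       ≡⟨ *-identityʳ (ι E) ⟩
        ι E                            ∎)) (sym (ι-suc E)))
        where open ≡-Reasoning

  log₂-exceeds : ∀ s {{_ : ℕ.NonZero s}} y T {a d} X → ι s * d ≡ 1ℚ → 0ℚ ≤ d → 0ℚ ≤ 1ℚ - ι y * d → 0ℚ < a → lower X a →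
    1ℚ < a * (1ℚ - ι y * d) ^ℚ T → ∃[ ℓ ] ι y * d * ι T < ℓ × Log₂Lower X ℓ
  log₂-exceeds s y T {a} {d} X sd≡1 0≤d 0≤w 0<a a<X 1<z =
    let m , b , 2ᵐ≤aᵇ , pTb<m = reject-power-log s y T sd≡1 0≤d 0≤w (<⇒≤ 0<a) 1<z
        ℓ , pT<ℓ , ℓb<m = slack-above {ι y * d * ι T} (ι-pos (suc b)) pTb<m
    in ℓ , pT<ℓ , log₂-lower m 0 b 0<a a<X (≤-trans 2ᵐ≤aᵇ (≤-reflexive (sym (*-identityˡ (a ^ℚ suc b)))))
                    (<-≤-trans ℓb<m (≤-reflexive (sym (+-identityʳ (ι m)))))

  pos-left : ∀ a {b} → 0ℚ ≤ b → 0ℚ < a * b → 0ℚ < a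
  pos-left a {b} 0≤b 0<ab = *-cancelʳ-<-nonNeg b {{nonNegative 0≤b}} (subst (_< a * b) (sym (*-zeroˡ b)) 0<ab)

  -- The lower cut of the integer s omits s, so y < m s has to be weakened to y < m c with c
  -- slightly below s.
  times-below : ∀ {s y m d} → s * d ≡ 1ℚ → 0ℚ < s → 0ℚ ≤ y → 0ℚ < m → y * d < m → ∃[ c ] 0ℚ ≤ c × c < s × y < m * c
  times-below {s} {y} {m} {d} sd≡1 0<s 0≤y 0<m yd<m =
    let c , c<s , y<cm = slack-below {s} {m} {y} 0<m (subst (_< s * m)
          (trans (solve 3 (λ s y d → s :* (y :* d) := y :* (s :* d)) refl s y d) (trans (cong (y *_) sd≡1) (*-identityʳ y)))
          (*-monoʳ-<-pos s {{positive 0<s}} yd<m))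
    in c , <⇒≤ (pos-left c (<⇒≤ 0<m) (≤-<-trans 0≤y y<cm)) , c<s , subst (y <_) (*-comm c m) y<cm

  -- Division of x s ≤ y by s: if a rational m > y/s were below x, then m c > y for some c < s,
  -- which would put y in its own lower cut. Locatedness then leaves only x < r.
  ratio-upper : ∀ s {{_ : ℕ.NonZero s}} y x {d r} → ι s * d ≡ 1ℚ → 0ℚ ≤ d → x *ℝ fromℕ s ≤ℝ fromℕ y → ι y * d < r → upper x r
  ratio-upper s y x {d} {r} sd≡1 0≤d xs≤y p<r =
    let m , p<m , m<r = <-dense p<r in [ (λ m<x → ⊥-elim (too-large m<x p<m)) , (λ x<r → x<r) ]′ (located x m<r)
    where
    too-large : ∀ {m} → lower x m → ¬ (ι y * d < m)
    too-large {m} m<x p<m =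
      let 0<m = ≤-<-trans {0ℚ} {ι y * d} (*nn (ι-nn y) 0≤d) p<m
          c , 0≤c , c<s , y<mc = times-below sd≡1 (ι-pos s) (ι-nn y) 0<m p<m
      in <-irrefl {ι y} refl (xs≤y (*-lower⁺ x (fromℕ s) {m} {c} {ι y} (<⇒≤ 0<m) 0≤c m<x c<s y<mc))

  -- The margin in p τ < ℓ is distributed over two factors: r slightly above p, and m slightly below
  -- 1/r. When r bounds x from above, m is then below the reciprocal of x.
  inverse-between : ∀ {p τ ℓ} → 0ℚ ≤ p → 0ℚ ≤ τ → p * τ < ℓ → ∃[ r ] ∃[ m ] p < r × 0ℚ ≤ m × m * r < 1ℚ × τ < m * ℓ
  inverse-between {p} {τ} {ℓ} 0≤p 0≤τ pτ<ℓ =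
    let r , p<r , rτ<ℓ = widen (split 0ℚ τ)
        0<r = ≤-<-trans 0≤p p<r
        z , 0<z , rz≡1 = solve-for r 1ℚ 0<r 0<1
        m , m<z , τ<mℓ = slack-below {z} {ℓ} {τ} 0<ℓ (subst (_< z * ℓ)
          (trans (solve 3 (λ z r t → z :* (r :* t) := r :* z :* t) refl z r τ) (trans (cong (_* τ) rz≡1) (*-identityˡ τ)))
          (*-monoʳ-<-pos z {{positive 0<z}} rτ<ℓ))
    in r , m , p<r , <⇒≤ (pos-left m (<⇒≤ 0<ℓ) (≤-<-trans 0≤τ τ<mℓ)) ,
       subst (m * r <_) (trans (*-comm z r) rz≡1) (*mono-<ʳ 0<r m<z) , τ<mℓ
    where
    0<ℓ : 0ℚ < ℓ
    0<ℓ = ≤-<-trans (*nn 0≤p 0≤τ) pτ<ℓ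
    widen : 0ℚ < τ ⊎ τ ≤ 0ℚ → ∃[ r ] p < r × r * τ < ℓ
    widen (inj₁ 0<τ) = slack-above 0<τ pτ<ℓ
    -- `slack-above` requires a positive factor; for τ ≤ 0 enlarging p cannot increase p τ, so p + 1
    -- will do.
    widen (inj₂ τ≤0) = p + 1ℚ , <by 1ℚ 0<1 refl ,
      ≤-<-trans (≤by (- τ) (neg-antimono-≤ τ≤0) (solve 2 (λ p t → (p :+ con 1ℚ) :* t :+ (:- t) := p :* t) refl p τ)) pτ<ℓ

  -- If p T < ℓ, some m below the reciprocal of x has m ℓ > T, and the hypothesis on the product
  -- would place T in its own lower cut.
  log-budget : ∀ x {{_ : IsPositive x}} L T {p ℓ} → x ⁻¹ *ℝ L ≤ℝ fromℕ T → 0ℚ ≤ p → (∀ {r} → p < r → upper x r) →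
    lower L ℓ → ℓ ≤ p * ι T
  log-budget x L T {p} {ℓ} xL≤T 0≤p x≤p ℓ<L = ≮⇒≥ λ pT<ℓ →
    let r , m , p<r , 0≤m , mr<1 , T<mℓ = inverse-between 0≤p (ι-nn T) pT<ℓ
        0≤ℓ = <⇒≤ (≤-<-trans {0ℚ} {p * ι T} (*nn 0≤p (ι-nn T)) pT<ℓ)
    in <-irrefl {ι T} refl (xL≤T (*-lower⁺ (x ⁻¹) L {m} {ℓ} {ι T} 0≤m 0≤ℓ (r , x≤p p<r , mr<1) ℓ<L T<mℓ))

  -- Here a is just below τ/u. It is kept under a product c z with c < τ and z < 1/u because the
  -- lower cut of `fromℕ t *ℝ ρ ⁻¹` is entered through separate bounds of the factors.
  inverse-factors : ∀ {u τ W} → 0ℚ < u → 0ℚ ≤ τ → 0ℚ ≤ W → u < τ * W →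
    ∃[ c ] ∃[ z ] ∃[ a ] 0ℚ ≤ c × c < τ × 0ℚ ≤ z × z * u < 1ℚ × 0ℚ < a × a < c * z × 1ℚ < a * W
  inverse-factors {u} {τ} {W} 0<u 0≤τ 0≤W u<τW =
    let v , 0<v , uv≡1 = solve-for u 1ℚ 0<u 0<1
        z , z<v , 1<zτW = slack-below {v} 0<τW (subst (_< v * (τ * W)) (trans (*-comm v u) uv≡1)
          (*-monoʳ-<-pos v {{positive 0<v}} u<τW))
        0<z = pos-left z (<⇒≤ 0<τW) (<-trans 0<1 1<zτW)
        c , c<τ , 1<czW = slack-below {τ} (*pos 0<z 0<W) (subst (1ℚ <_)
          (solve 3 (λ z t w → z :* (t :* w) := t :* (z :* w)) refl z τ W) 1<zτW)
        a , a<cz , 1<aW = slack-below {c * z} 0<W (subst (1ℚ <_) (sym (*-assoc c z W)) 1<czW)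
    in c , z , a , <⇒≤ (pos-left c (<⇒≤ (*pos 0<z 0<W)) (<-trans 0<1 1<czW)) , c<τ ,
       <⇒≤ 0<z , subst (z * u <_) (trans (*-comm v u) uv≡1) (*mono-<ʳ 0<u z<v) ,
       pos-left a 0≤W (<-trans 0<1 1<aW) , a<cz , 1<aW
    where
    0<τW : 0ℚ < τ * W
    0<τW = <-trans 0<u u<τW
    0<W : 0ℚ < W
    0<W = pos-left W 0≤τ (subst (0ℚ <_) (*-comm τ W) 0<τW)

  -- If t (1 - p)^T exceeded u > ρ, some a < t/ρ would satisfy a (1 - p)^T > 1, so log (t/ρ) > p T.
  blocks-fail-bound : ∀ s {{_ : ℕ.NonZero s}} y x {{_ : IsPositive x}} t {{_ : ℕ.NonZero t}} ρ {{_ : IsPositive ρ}} T {d} →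
    ι s * d ≡ 1ℚ → 0ℚ ≤ d → 0ℚ ≤ 1ℚ - ι y * d → x *ℝ fromℕ s ≤ℝ fromℕ y →
    x ⁻¹ *ℝ log₂ (fromℕ t *ℝ ρ ⁻¹) ≤ℝ fromℕ T →
    ∀ {u} → upper ρ u → ι t * (1ℚ - ι y * d) ^ℚ T ≤ u
  blocks-fail-bound s y x t ρ T {d} sd≡1 0≤d 0≤w xs≤y xL≤T {u} ρ<u = ≮⇒≥ contradict
    where
    W : ℚ
    W = (1ℚ - ι y * d) ^ℚ T
    contradict : ¬ (u < ι t * W)
    contradict u<tW =
      let c , z , a , 0≤c , c<t , 0≤z , zu<1 , 0<a , a<cz , 1<aW =
            inverse-factors (pos-upper ρ ρ<u) (ι-nn t) (^-nn T 0≤w) u<tW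
          ℓ , pT<ℓ , ℓ<L = log₂-exceeds s y T {a} {d} (fromℕ t *ℝ ρ ⁻¹) sd≡1 0≤d 0≤w 0<a
            (*-lower⁺ (fromℕ t) (ρ ⁻¹) {c} {z} {a} 0≤c 0≤z c<t (u , ρ<u , zu<1) a<cz) 1<aW
      in <-irrefl {ℓ} refl (≤-<-trans {ℓ} {ι y * d * ι T} {ℓ}
           (log-budget x (log₂ (fromℕ t *ℝ ρ ⁻¹)) T {ι y * d} {ℓ} xL≤T (*nn (ι-nn y) 0≤d)
             (ratio-upper s y x sd≡1 0≤d xs≤y) ℓ<L) pT<ℓ)

-- Exact distribution of the procedure, with failure and success probabilities.

module Law where
  open Notation

  sum : {A : Set} → (A → ℚ) → List A → ℚ
  sum f xs = foldr _+_ 0ℚ (map f xs)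

  infixr 7 [_]*_
  [_]*_ : Bool → ℚ → ℚ
  [ b ]* q = if b then q else 0ℚ

  module _ {A : Set} where
    sum-cong : ∀ {f g : A → ℚ} xs → (∀ x → f x ≡ g x) → sum f xs ≡ sum g xs
    sum-cong []       f≗g = refl
    sum-cong (x ∷ xs) f≗g = cong₂ _+_ (f≗g x) (sum-cong xs f≗g)

    sum-+ : ∀ (f g : A → ℚ) xs → sum (λ x → f x + g x) xs ≡ sum f xs + sum g xs
    sum-+ f g []       = refl
    sum-+ f g (x ∷ xs) = trans (cong ((f x + g x) +_) (sum-+ f g xs))
      (solve 4 (λ a b c d → a :+ b :+ (c :+ d) := a :+ c :+ (b :+ d)) refl (f x) (g x) (sum f xs) (sum g xs))

    sum-const : ∀ c (xs : List A) → sum (λ _ → c) xs ≡ ι (length xs) * c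
    sum-const c []       = sym (*-zeroˡ c)
    sum-const c (x ∷ xs) = trans (cong (c +_) (sum-const c xs)) (trans
      (solve 2 (λ c n → c :+ n :* c := (n :+ con 1ℚ) :* c) refl c (ι (length xs)))
      (cong (_* c) (sym (ι-suc (length xs)))))

    sum-++ : ∀ (f : A → ℚ) xs ys → sum f (xs ++ ys) ≡ sum f xs + sum f ys
    sum-++ f []       ys = sym (+-identityˡ (sum f ys))
    sum-++ f (x ∷ xs) ys = trans (cong (f x +_) (sum-++ f xs ys)) (sym (+-assoc (f x) (sum f xs) (sum f ys)))

    sum-filter : ∀ (f : A → ℚ) p xs → sum f (filterᵇ p xs) ≡ sum (λ x → [ p x ]* f x) xs
    sum-filter f p []       = refl
    sum-filter f p (x ∷ xs) with p x
    ... | true  = cong (f x +_) (sum-filter f p xs)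
    ... | false = trans (sum-filter f p xs) (sym (+-identityˡ _))

    sum-nonNeg : ∀ {f : A → ℚ} xs → (∀ x → 0ℚ ≤ f x) → 0ℚ ≤ sum f xs
    sum-nonNeg []       0≤f = ≤-refl
    sum-nonNeg (x ∷ xs) 0≤f = +nn (0≤f x) (sum-nonNeg xs 0≤f)

  sum-map : ∀ {A B : Set} (f : B → ℚ) (g : A → B) xs → sum f (map g xs) ≡ sum (λ x → f (g x)) xs
  sum-map f g []       = refl
  sum-map f g (x ∷ xs) = cong (f (g x) +_) (sum-map f g xs)

  _≡ᵇ_ : ∀ {n} → Point n → Point n → Bool
  x ≡ᵇ y = does (Vec.≡-dec Bool._≟_ x y)

  sum-zero : ∀ {A : Set} (xs : List A) → sum (λ _ → 0ℚ) xs ≡ 0ℚ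
  sum-zero xs = trans (sum-const 0ℚ xs) (*-zeroʳ (ι (length xs)))

  -- The points split by their first bit: the half with the wrong bit is a sum of zeros by
  -- computation, and the other half is the induction hypothesis.
  sum-allPoints-≡ᵇ : ∀ {n} (f : Point n → ℚ) y → sum (λ x → [ x ≡ᵇ y ]* f x) (allPoints n) ≡ f y
  sum-allPoints-≡ᵇ f [] = +-identityʳ (f [])
  sum-allPoints-≡ᵇ {suc n} f (b ∷ y) = trans (sum-++ g (map (false ∷_) ps) (map (true ∷_) ps))
    (trans (cong₂ _+_ (sum-map g (false ∷_) ps) (sum-map g (true ∷_) ps)) (halves b))
    where
    ps : List (Point n)
    ps = allPoints n
    g : Point (suc n) → ℚ
    g x = [ x ≡ᵇ (b ∷ y) ]* f x
    halves : ∀ b → sum (λ x → [ (false ∷ x) ≡ᵇ (b ∷ y) ]* f (false ∷ x)) ps +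
                   sum (λ x → [ (true ∷ x) ≡ᵇ (b ∷ y) ]* f (true ∷ x)) ps ≡ f (b ∷ y)
    halves false = trans (cong₂ _+_ (sum-allPoints-≡ᵇ (λ x → f (false ∷ x)) y) (sum-zero ps)) (+-identityʳ _)
    halves true  = trans (cong₂ _+_ (sum-zero ps) (sum-allPoints-≡ᵇ (λ x → f (true ∷ x)) y)) (+-identityˡ _)

  0≤1/ : ∀ s {{_ : ℕ.NonZero s}} → 0ℚ ≤ ℤ.+ 1 / s
  0≤1/ s = <⇒≤ (positive⁻¹ (ℤ.+ 1 / s) {{normalize-pos 1 s}})

  average : ∀ {n} (Y : Subset n) {{_ : ℕ.NonZero (card Y)}} → (Point n → ℚ) → ℚ
  average Y f = (ℤ.+ 1 / card Y) * sum f (elements Y)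

  module _ {n : ℕ} (Y : Subset n) {{_ : ℕ.NonZero (card Y)}} where
    card*average : ∀ f → ι (card Y) * average Y f ≡ sum f (elements Y)
    card*average f = trans (sym (*-assoc (ι (card Y)) (ℤ.+ 1 / card Y) (sum f (elements Y))))
      (trans (cong (_* sum f (elements Y)) (1/-inverse (card Y))) (*-identityˡ _))

    average-cong : ∀ {f g} → (∀ x → f x ≡ g x) → average Y f ≡ average Y g
    average-cong f≗g = cong ((ℤ.+ 1 / card Y) *_) (sum-cong (elements Y) f≗g)

    average-const : ∀ c → average Y (λ _ → c) ≡ c
    average-const c = trans (cong ((ℤ.+ 1 / card Y) *_) (sum-const c (elements Y)))
      (trans (solve 3 (λ i k c → i :* (k :* c) := k :* i :* c) refl (ℤ.+ 1 / card Y) (ι (card Y)) c)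
        (trans (cong (_* c) (1/-inverse (card Y))) (*-identityˡ c)))

    -- Exchanging the indicator of Y with that of x = y turns the sum over Y into one over all
    -- points, where only y survives. A point outside Y gives zero on both sides.
    average-≡ᵇ : ∀ y c → average Y (λ x → [ x ≡ᵇ y ]* c) ≡ uniform Y y * c
    average-≡ᵇ y c = trans (cong ((ℤ.+ 1 / card Y) *_) (trans (sum-filter (λ x → [ x ≡ᵇ y ]* c) Y (allPoints n))
        (trans (sum-cong (allPoints n) swap) (sum-allPoints-≡ᵇ (λ x → [ Y x ]* c) y)))) pull
      where
      swap : ∀ x → [ Y x ]* [ x ≡ᵇ y ]* c ≡ [ x ≡ᵇ y ]* [ Y x ]* c
      swap x with Y x | x ≡ᵇ y
      ... | true  | _     = refl
      ... | false | true  = refl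
      ... | false | false = refl
      pull : (ℤ.+ 1 / card Y) * ([ Y y ]* c) ≡ uniform Y y * c
      pull with Y y
      ... | true  = refl
      ... | false = trans (*-zeroʳ (ℤ.+ 1 / card Y)) (sym (*-zeroˡ c))

  module Expectation {n : ℕ} (S : Subset n) {{_ : ℕ.NonZero (card S)}} where
    -- `Pr` generalised from events to rational functions: in a sequential composition the first
    -- program is integrated against the success probability of the second, which is not an
    -- indicator.
    𝔼 : ∀ {A} → Program n A → (A → ℚ) → ℚ
    𝔼 (return a) f = f a
    𝔼 (ask x k)  f = 𝔼 (k (S x)) f
    𝔼 (sample k) f = average S (λ x → 𝔼 (k x) f)

    Pr≡𝔼 : ∀ {A} (P : Program n A) E → Pr S P E ≡ 𝔼 P (λ a → [ E a ]* 1ℚ)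
    Pr≡𝔼 (return a) E = refl
    Pr≡𝔼 (ask x k)  E = Pr≡𝔼 (k (S x)) E
    Pr≡𝔼 (sample k) E = average-cong S λ x → Pr≡𝔼 (k x) E

    𝔼-cong : ∀ {A} (P : Program n A) {f g : A → ℚ} → (∀ a → f a ≡ g a) → 𝔼 P f ≡ 𝔼 P g
    𝔼-cong (return a) f≗g = f≗g a
    𝔼-cong (ask x k)  f≗g = 𝔼-cong (k (S x)) f≗g
    𝔼-cong (sample k) f≗g = average-cong S λ x → 𝔼-cong (k x) f≗g

    𝔼-const : ∀ {A} (P : Program n A) c → 𝔼 P (λ _ → c) ≡ c
    𝔼-const (return a) c = refl
    𝔼-const (ask x k)  c = 𝔼-const (k (S x)) c
    𝔼-const (sample k) c = trans (average-cong S λ x → 𝔼-const (k x) c) (average-const S c)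

    𝔼->>= : ∀ {A B} (P : Program n A) (k : A → Program n B) f → 𝔼 (P >>= k) f ≡ 𝔼 P (λ a → 𝔼 (k a) f)
    𝔼->>= (return a) k f = refl
    𝔼->>= (ask x j)  k f = 𝔼->>= (j (S x)) k f
    𝔼->>= (sample j) k f = average-cong S λ x → 𝔼->>= (j x) k f

    𝔼-deterministic : ∀ {A} (Q : Query n A) f → 𝔼 (deterministic Q) f ≡ f (evaluate S Q)
    𝔼-deterministic (return a) f = refl
    𝔼-deterministic (ask x k)  f = 𝔼-deterministic (k (S x)) f

  accepted : ∀ {n} → Subset n → (Point n → Query n Bool) → Subset n
  accepted S member x = evaluate S (member x)

  module Rejection {n : ℕ} (S : Subset n) {{_ : ℕ.NonZero (card S)}} (member : Point n → Query n Bool)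
    {{_ : ℕ.NonZero (card (accepted S member))}} (Y⊆S : ∀ x → T (accepted S member x) → T (S x)) where
    open Expectation S

    Y : Subset n
    Y = accepted S member

    reject : ℚ
    reject = 1ℚ - ι (card Y) * (ℤ.+ 1 / card S)

    -- This is where Y ⊆ S enters: the indicator of S is absorbed by that of Y.
    sum-elements-⊆ : ∀ f → sum (λ x → [ Y x ]* f x) (elements S) ≡ sum f (elements Y)
    sum-elements-⊆ f = trans (sum-filter (λ x → [ Y x ]* f x) S (allPoints n))
      (trans (sum-cong (allPoints n) absorb) (sym (sum-filter f Y (allPoints n))))
      where
      absorb : ∀ x → [ S x ]* [ Y x ]* f x ≡ [ Y x ]* f x
      absorb x with S x | Y x | Y⊆S x
      ... | true  | _     | _   = refl
      ... | false | true  | y⇒s = ⊥-elim (y⇒s _)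
      ... | false | false | _   = refl

    sum-split : ∀ f c → sum (λ x → if Y x then f x else c) (elements S) ≡
      ι (card Y) * average Y f + (ι (card S) - ι (card Y)) * c
    sum-split f c = begin
      sum (λ x → if Y x then f x else c) (elements S)
        ≡⟨ sum-cong (elements S) pointwise ⟩
      -- Writing the branch as c plus the indicator of Y times f - c leaves a constant sum and a sum
      -- that can be moved from S to Y.
      sum (λ x → c + [ Y x ]* (f x + - 1ℚ * c)) (elements S)
        ≡⟨ sum-+ (λ _ → c) _ (elements S) ⟩
      sum (λ _ → c) (elements S) + sum (λ x → [ Y x ]* (f x + - 1ℚ * c)) (elements S)
        ≡⟨ cong₂ _+_ (sum-const c (elements S)) (sum-elements-⊆ _) ⟩
      ι (card S) * c + sum (λ x → f x + - 1ℚ * c) (elements Y)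
        ≡⟨ cong ((ι (card S) * c) +_) (trans (sum-+ f (λ _ → - 1ℚ * c) (elements Y))
             (cong₂ _+_ (sym (card*average Y f)) (sum-const (- 1ℚ * c) (elements Y)))) ⟩
      ι (card S) * c + (ι (card Y) * average Y f + ι (card Y) * (- 1ℚ * c))
        ≡⟨ solve 4 (λ s y a c → s :* c :+ (y :* a :+ y :* (:- con 1ℚ :* c)) := y :* a :+ (s :- y) :* c) refl
             (ι (card S)) (ι (card Y)) (average Y f) c ⟩
      ι (card Y) * average Y f + (ι (card S) - ι (card Y)) * c ∎
      where
      open ≡-Reasoning
      pointwise : ∀ x → (if Y x then f x else c) ≡ c + [ Y x ]* (f x + - 1ℚ * c)
      pointwise x with Y x
      ... | true  = solve 2 (λ a c → a := c :+ (a :+ :- con 1ℚ :* c)) refl (f x) c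
      ... | false = sym (+-identityʳ c)

    -- The law of one draw: acceptance has probability |Y|/|S| = 1 - `reject`, and an accepted point
    -- is uniform on Y.
    average-split : ∀ f c → average S (λ x → if Y x then f x else c) ≡ (1ℚ - reject) * average Y f + reject * c
    average-split f c = trans (cong ((ℤ.+ 1 / card S) *_) (sum-split f c)) (trans
      (solve 5 (λ i s y a c → i :* (y :* a :+ (s :- y) :* c) :=
                  (con 1ℚ :- (con 1ℚ :- y :* i)) :* a :+ (s :* i :- y :* i) :* c) refl
         (ℤ.+ 1 / card S) (ι (card S)) (ι (card Y)) (average Y f) c)
      (cong (λ z → (1ℚ - reject) * average Y f + (z - ι (card Y) * (ℤ.+ 1 / card S)) * c) (1/-inverse (card S))))

    -- The rejection probability is the average over S of the indicator of rejection, so its sign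
    -- needs no comparison of cardinalities.
    0≤reject : 0ℚ ≤ reject
    0≤reject = subst (0ℚ ≤_)
      (trans (average-split (λ _ → 0ℚ) 1ℚ) (trans (cong (λ z → (1ℚ - reject) * z + reject * 1ℚ) (average-const Y 0ℚ))
        (solve 1 (λ r → (con 1ℚ :- r) :* con 0ℚ :+ r :* con 1ℚ := r) refl reject)))
      (*nn (0≤1/ (card S))
           (sum-nonNeg (elements S) pointwise))
      where
      pointwise : ∀ x → 0ℚ ≤ (if Y x then 0ℚ else 1ℚ)
      pointwise x with Y x
      ... | true  = ≤-refl
      ... | false = <⇒≤ 0<1

    firstOfBlock : ∀ T → Program n (Maybe (Point n))
    firstOfBlock T = drawBlock T >>= firstAccepted member

    -- The whole block is drawn before any point is tested. After an acceptance the remaining draws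
    -- do not influence the result and integrate to 1.
    𝔼-firstOfBlock-suc : ∀ T f → 𝔼 (firstOfBlock (suc T)) f ≡
      average S (λ x → if Y x then f (just x) else 𝔼 (firstOfBlock T) f)
    𝔼-firstOfBlock-suc T f = average-cong S λ x → begin
      𝔼 ((drawBlock T >>= λ xs → return (x ∷ xs)) >>= firstAccepted member) f
        ≡⟨ 𝔼->>= (drawBlock T >>= λ xs → return (x ∷ xs)) (firstAccepted member) f ⟩
      𝔼 (drawBlock T >>= λ xs → return (x ∷ xs)) (λ xs → 𝔼 (firstAccepted member xs) f)
        ≡⟨ 𝔼->>= (drawBlock T) (λ xs → return (x ∷ xs)) _ ⟩
      𝔼 (drawBlock T) (λ xs → 𝔼 (firstAccepted member (x ∷ xs)) f)
        ≡⟨ 𝔼-cong (drawBlock T) (λ xs → trans (𝔼->>= (deterministic (member x)) _ f) (𝔼-deterministic (member x) _)) ⟩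
      𝔼 (drawBlock T) (λ xs → 𝔼 (if Y x then return (just x) else firstAccepted member xs) f)
        ≡⟨ branch x (Y x) ⟩
      (if Y x then f (just x) else 𝔼 (firstOfBlock T) f) ∎
      where
      open ≡-Reasoning
      branch : ∀ x b → 𝔼 (drawBlock T) (λ xs → 𝔼 (if b then return (just x) else firstAccepted member xs) f) ≡
        (if b then f (just x) else 𝔼 (firstOfBlock T) f)
      branch x true  = 𝔼-const (drawBlock T) (f (just x))
      branch x false = sym (𝔼->>= (drawBlock T) (firstAccepted member) f)

    𝔼-firstOfBlock : ∀ T f → 𝔼 (firstOfBlock T) f ≡
      (1ℚ - reject ^ℚ T) * average Y (λ x → f (just x)) + reject ^ℚ T * f nothing
    𝔼-firstOfBlock zero    f = solve 2 (λ a b → b := (con 1ℚ :- con 1ℚ) :* a :+ con 1ℚ :* b) refl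
      (average Y (λ x → f (just x))) (f nothing)
    𝔼-firstOfBlock (suc T) f = trans (𝔼-firstOfBlock-suc T f)
      (trans (average-split (λ x → f (just x)) (𝔼 (firstOfBlock T) f))
      (trans (cong (λ z → (1ℚ - reject) * average Y (λ x → f (just x)) + reject * z) (𝔼-firstOfBlock T f))
        (solve 4 (λ r rᵀ a b → (con 1ℚ :- r) :* a :+ r :* ((con 1ℚ :- rᵀ) :* a :+ rᵀ :* b) :=
                               (con 1ℚ :- r :* rᵀ) :* a :+ r :* rᵀ :* b) refl
          reject (reject ^ℚ T) (average Y (λ x → f (just x))) (f nothing))))

    accept : ℕ → ℚ
    accept T = 1ℚ - reject ^ℚ T

    -- What remains of f, as a function of the result of the other t blocks, once the first block
    -- has returned y.
    extend : ∀ {t} → (Maybe (Vec (Point n) (suc t)) → ℚ) → Point n → Maybe (Vec (Point n) t) → ℚ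
    extend f y nothing   = f nothing
    extend f y (just ys) = f (just (y ∷ ys))

    𝔼-sampleTuple-suc : ∀ t T f → 𝔼 (sampleTuple member (suc t) T) f ≡
      accept T * average Y (λ y → 𝔼 (sampleTuple member t T) (extend f y)) + reject ^ℚ T * f nothing
    𝔼-sampleTuple-suc t T f = trans (trans (𝔼->>= (drawBlock T) _ f)
      (trans (𝔼-cong (drawBlock T) λ block → trans (𝔼->>= (firstAccepted member block) _ f)
               (𝔼-cong (firstAccepted member block) λ
                 { nothing  → refl
                 ; (just y) → trans (𝔼->>= (sampleTuple member t T) _ f)
                     (𝔼-cong (sampleTuple member t T) λ { nothing → refl ; (just ys) → refl }) }))
             (sym (𝔼->>= (drawBlock T) (firstAccepted member) next))))
      (𝔼-firstOfBlock T next)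
      where
      next : Maybe (Point n) → ℚ
      next nothing  = f nothing
      next (just y) = 𝔼 (sampleTuple member t T) (extend f y)

    Pr-nothing : ∀ t T → 0ℚ ≤ reject ^ℚ T → reject ^ℚ T ≤ 1ℚ → Pr S (sampleTuple member t T) is-nothing ≤ ι t * reject ^ℚ T
    Pr-nothing t T 0≤rᵀ rᵀ≤1 = subst (_≤ ι t * reject ^ℚ T) (sym (Pr≡𝔼 (sampleTuple member t T) is-nothing)) (union t)
      where
      union : ∀ t → 𝔼 (sampleTuple member t T) (λ a → [ is-nothing a ]* 1ℚ) ≤ ι t * reject ^ℚ T
      union zero    = ≤-reflexive (sym (*-zeroˡ (reject ^ℚ T)))
      union (suc t) = ≤-trans (≤-reflexive step) (≤-trans
        (+-monoˡ-≤ (reject ^ℚ T * 1ℚ) (*mono-≤ (sub-nn rᵀ≤1) (*nn (ι-nn t) 0≤rᵀ) accept≤1 (union t)))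
        (≤-reflexive (trans (solve 2 (λ k r → con 1ℚ :* (k :* r) :+ r :* con 1ℚ := (k :+ con 1ℚ) :* r) refl (ι t) (reject ^ℚ T))
          (cong (_* reject ^ℚ T) (sym (ι-suc t))))))
        where
        accept≤1 : accept T ≤ 1ℚ
        accept≤1 = ≤by (reject ^ℚ T) 0≤rᵀ (solve 1 (λ r → con 1ℚ :- r :+ r := con 1ℚ) refl (reject ^ℚ T))
        step : 𝔼 (sampleTuple member (suc t) T) (λ a → [ is-nothing a ]* 1ℚ) ≡
          accept T * 𝔼 (sampleTuple member t T) (λ a → [ is-nothing a ]* 1ℚ) + reject ^ℚ T * 1ℚ
        step = trans (𝔼-sampleTuple-suc t T _) (cong (λ z → accept T * z + reject ^ℚ T * 1ℚ)
          (trans (average-cong Y λ y → 𝔼-cong (sampleTuple member t T) λ { nothing → refl ; (just ys) → refl })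
            (average-const Y _)))

    Pr-just : ∀ t T → Pr S (sampleTuple member t T) is-just ≡ accept T ^ℚ t
    Pr-just t T = trans (Pr≡𝔼 (sampleTuple member t T) is-just) (law t)
      where
      law : ∀ t → 𝔼 (sampleTuple member t T) (λ a → [ is-just a ]* 1ℚ) ≡ accept T ^ℚ t
      law zero    = refl
      law (suc t) = trans (𝔼-sampleTuple-suc t T _)
        (trans (cong (λ z → accept T * z + reject ^ℚ T * 0ℚ)
          (trans (average-cong Y λ y → trans (𝔼-cong (sampleTuple member t T) λ { nothing → refl ; (just ys) → refl }) (law t))
            (average-const Y _)))
          (solve 2 (λ a r → a :+ r :* con 0ℚ := a) refl (accept T * accept T ^ℚ t) (reject ^ℚ T)))

    Pr-output : ∀ {t} T v → Pr S (sampleTuple member t T) (λ a → (v isOutput a) ∧ is-just a) ≡ uniform^⊗ Y v * accept T ^ℚ t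
    Pr-output {t} T v = trans (Pr≡𝔼 (sampleTuple member t T) _) (law v)
      where
      output : ∀ {t} → Vec (Point n) t → Maybe (Vec (Point n) t) → ℚ
      output v a = [ (v isOutput a) ∧ is-just a ]* 1ℚ
      law : ∀ {t} v → 𝔼 (sampleTuple member t T) (output v) ≡ uniform^⊗ Y v * accept T ^ℚ t
      law []                = refl
      law {suc t} (y ∷ ys) = trans (𝔼-sampleTuple-suc t T _)
        (trans (cong (λ z → accept T * z + reject ^ℚ T * 0ℚ) (trans (average-cong Y head) (average-≡ᵇ Y y _)))
          (solve 5 (λ a r u w aᵗ → a :* (u :* (w :* aᵗ)) :+ r :* con 0ℚ := u :* w :* (a :* aᵗ)) refl
            (accept T) (reject ^ℚ T) (uniform Y y) (uniform^⊗ Y ys) (accept T ^ℚ t)))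
        where
        -- Equality of vectors splits into heads and tails, so after the first block the event for y
        -- ∷ ys is either impossible or the event for ys.
        tail : ∀ x a → extend (output (y ∷ ys)) x a ≡ [ x ≡ᵇ y ]* output ys a
        tail x nothing with x ≡ᵇ y
        ... | true  = refl
        ... | false = refl
        tail x (just xs) with x ≡ᵇ y
        ... | true  = refl
        ... | false = refl
        head : ∀ x → 𝔼 (sampleTuple member t T) (extend (output (y ∷ ys)) x) ≡
          [ x ≡ᵇ y ]* (uniform^⊗ Y ys * accept T ^ℚ t)
        head x = trans (𝔼-cong (sampleTuple member t T) (tail x)) (pull (x ≡ᵇ y))
          where
          pull : ∀ b → 𝔼 (sampleTuple member t T) (λ a → [ b ]* output ys a) ≡ [ b ]* (uniform^⊗ Y ys * accept T ^ℚ t)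
          pull true  = law ys
          pull false = 𝔼-const (sampleTuple member t T) 0ℚ

-- Worst-case counts of samples and membership queries.

module Cost where
  open Notation

  maximum : {A : Set} → (A → ℕ) → List A → ℕ
  maximum f xs = foldr ℕ._⊔_ 0 (map f xs)

  -- A uniform bound b on the cost of the continuation can be taken out of the maximum over sample
  -- outcomes; this is what makes costs additive under `_>>=_`.
  maximum-≤-+ : ∀ {A : Set} {f g : A → ℕ} b xs → (∀ x → f x ℕ.≤ g x ℕ.+ b) → maximum f xs ℕ.≤ maximum g xs ℕ.+ b
  maximum-≤-+         b []       f≤g = ℕ.z≤n
  maximum-≤-+ {g = g} b (x ∷ xs) f≤g = ℕ.⊔-lub
    (ℕ.≤-trans (f≤g x) (ℕ.+-monoˡ-≤ b (ℕ.m≤m⊔n (g x) (maximum g xs))))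
    (ℕ.≤-trans (maximum-≤-+ b xs f≤g) (ℕ.+-monoˡ-≤ b (ℕ.m≤n⊔m (g x) (maximum g xs))))

  maximum-lub : ∀ {A : Set} {f : A → ℕ} {b} xs → (∀ x → f x ℕ.≤ b) → maximum f xs ℕ.≤ b
  maximum-lub []       f≤b = ℕ.z≤n
  maximum-lub (x ∷ xs) f≤b = ℕ.⊔-lub (f≤b x) (maximum-lub xs f≤b)

  module _ {n : ℕ} (S : Subset n) where
    maxSamples->>= : ∀ {A B b} (P : Program n A) {k : A → Program n B} → (∀ a → maxSamples S (k a) ℕ.≤ b) →
      maxSamples S (P >>= k) ℕ.≤ maxSamples S P ℕ.+ b
    maxSamples->>= (return a) k≤b = k≤b a
    maxSamples->>= (ask x j)  k≤b = maxSamples->>= (j (S x)) k≤b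
    maxSamples->>= {b = b} (sample j) k≤b = ℕ.s≤s (maximum-≤-+ b (elements S) λ x → maxSamples->>= (j x) k≤b)

    maxQueries->>= : ∀ {A B b} (P : Program n A) {k : A → Program n B} → (∀ a → maxQueries S (k a) ℕ.≤ b) →
      maxQueries S (P >>= k) ℕ.≤ maxQueries S P ℕ.+ b
    maxQueries->>= (return a) k≤b = k≤b a
    maxQueries->>= (ask x j)  k≤b = ℕ.s≤s (maxQueries->>= (j (S x)) k≤b)
    maxQueries->>= {b = b} (sample j) k≤b = maximum-≤-+ b (elements S) λ x → maxQueries->>= (j x) k≤b

    bind-samples : ∀ {A B a b} (P : Program n A) {k : A → Program n B} → maxSamples S P ℕ.≤ a →
      (∀ x → maxSamples S (k x) ℕ.≤ b) → maxSamples S (P >>= k) ℕ.≤ a ℕ.+ b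
    bind-samples {b = b} P P≤a k≤b = ℕ.≤-trans (maxSamples->>= P k≤b) (ℕ.+-monoˡ-≤ b P≤a)

    bind-queries : ∀ {A B a b} (P : Program n A) {k : A → Program n B} → maxQueries S P ℕ.≤ a →
      (∀ x → maxQueries S (k x) ℕ.≤ b) → maxQueries S (P >>= k) ℕ.≤ a ℕ.+ b
    bind-queries {b = b} P P≤a k≤b = ℕ.≤-trans (maxQueries->>= P k≤b) (ℕ.+-monoˡ-≤ b P≤a)

    samples-deterministic : ∀ {A} (Q : Query n A) → maxSamples S (deterministic Q) ℕ.≤ 0
    samples-deterministic (return a) = ℕ.z≤n
    samples-deterministic (ask x k)  = samples-deterministic (k (S x))

    queries-deterministic : ∀ {A} (Q : Query n A) → maxQueries S (deterministic Q) ℕ.≤ queryCount S Q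
    queries-deterministic (return a) = ℕ.z≤n
    queries-deterministic (ask x k)  = ℕ.s≤s (queries-deterministic (k (S x)))

    samples-drawBlock : ∀ T → maxSamples S (drawBlock {n} T) ℕ.≤ T
    samples-drawBlock zero    = ℕ.z≤n
    samples-drawBlock (suc T) = ℕ.s≤s (maximum-lub (elements S) λ x → ℕ.≤-trans
      (bind-samples (drawBlock T) (samples-drawBlock T) λ xs → ℕ.z≤n) (ℕ.≤-reflexive (ℕ.+-identityʳ T)))

    queries-drawBlock : ∀ T → maxQueries S (drawBlock {n} T) ℕ.≤ 0
    queries-drawBlock zero    = ℕ.z≤n
    queries-drawBlock (suc T) = maximum-lub (elements S) λ x →
      bind-queries (drawBlock T) (queries-drawBlock T) λ xs → ℕ.z≤n

    module _ (member : Point n → Query n Bool) where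
      samples-firstAccepted : ∀ {T} (xs : Vec (Point n) T) → maxSamples S (firstAccepted member xs) ℕ.≤ 0
      samples-firstAccepted []       = ℕ.z≤n
      samples-firstAccepted (x ∷ xs) = bind-samples (deterministic (member x)) (samples-deterministic (member x))
        λ { true → ℕ.z≤n ; false → samples-firstAccepted xs }

      samples-sampleTuple : ∀ t T → maxSamples S (sampleTuple member t T) ℕ.≤ t ℕ.* T
      samples-sampleTuple zero    T = ℕ.z≤n
      samples-sampleTuple (suc t) T = bind-samples (drawBlock T) (samples-drawBlock T) λ xs →
        bind-samples (firstAccepted member xs) (samples-firstAccepted xs) λ
          { nothing  → ℕ.z≤n
          ; (just y) → ℕ.≤-trans (bind-samples (sampleTuple member t T) (samples-sampleTuple t T) λ
              { nothing → ℕ.z≤n ; (just ys) → ℕ.z≤n }) (ℕ.≤-reflexive (ℕ.+-identityʳ (t ℕ.* T))) }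

      module _ {M : ℕ} (member≤M : ∀ x → queryCount S (member x) ℕ.≤ M) where
        queries-firstAccepted : ∀ {T} (xs : Vec (Point n) T) → maxQueries S (firstAccepted member xs) ℕ.≤ T ℕ.* M
        queries-firstAccepted []       = ℕ.z≤n
        queries-firstAccepted (x ∷ xs) = bind-queries (deterministic (member x))
          (ℕ.≤-trans (queries-deterministic (member x)) (member≤M x))
          λ { true → ℕ.z≤n ; false → queries-firstAccepted xs }

        queries-sampleTuple : ∀ t T → maxQueries S (sampleTuple member t T) ℕ.≤ t ℕ.* (T ℕ.* M)
        queries-sampleTuple zero    T = ℕ.z≤n
        queries-sampleTuple (suc t) T = bind-queries (drawBlock T) (queries-drawBlock T) λ xs →
          bind-queries (firstAccepted member xs) (queries-firstAccepted xs) λ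
            { nothing  → ℕ.z≤n
            ; (just y) → ℕ.≤-trans (bind-queries (sampleTuple member t T) (queries-sampleTuple t T) λ
                { nothing → ℕ.z≤n ; (just ys) → ℕ.z≤n }) (ℕ.≤-reflexive (ℕ.+-identityʳ (t ℕ.* (T ℕ.* M)))) }

-- Rational bounds for the block length, one evaluation and the total cost.

module Bounds where
  open Notation
  open Cuts
  open Failure

  ^-mono-< : ∀ {a b} n → 0ℚ < a → a < b → a ^ℚ suc n < b ^ℚ suc n
  ^-mono-< {a} {b} zero    0<a a<b = subst₂ _<_ (sym (*-identityʳ a)) (sym (*-identityʳ b)) a<b
  ^-mono-< (suc n) 0<a a<b = *mono-< 0<a (^-pos (suc n) 0<a) a<b (^-mono-< n 0<a a<b)

  -- The exponent is a successor because the upper cut of x^0 omits 1. Openness of the cut supplies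
  -- c < b, and strict monotonicity restores the required margin.
  ^-upper : ∀ x {{_ : IsPositive x}} n {b} → upper x b → upper (x ^ℝ suc n) (b ^ℚ suc n)
  ^-upper x n x<b = let c , c<b , x<c = upper-open x x<b in
    ^-upper⁺ x (suc n) x<c (^-mono-< n (pos-upper x x<c) c<b)

  1<√⁻¹ : ∀ x {{_ : IsPositive x}} → x <ℝ 1ℝ → ∀ {s} → upper ((√ x) ⁻¹) s → 1ℚ < s
  1<√⁻¹ x x<1 {s} √x⁻¹<s = ≰⇒> λ s≤1 →
    let q , 1<q , q<x⁻¹ = 1<⁻¹ x x<1
        0≤s = <⇒≤ (pos-upper ((√ x) ⁻¹) {s} √x⁻¹<s)
    in <-irrefl {1ℚ} refl (<-trans {1ℚ} {q} 1<q (<-≤-trans {q} {s * s}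
         (lower<upper (x ⁻¹) {q} {s * s} q<x⁻¹ (√⁻¹-upper-square x {s} √x⁻¹<s)) (*mono-≤ 0≤s (<⇒≤ 0<1) s≤1 s≤1)))

  2<e : lower e (ι 2)
  -- The partial sum 1 + 1 + 1/2 already exceeds 2.
  2<e = 2 , *<* (ℤ.+<+ (ℕ.s≤s (ℕ.s≤s (ℕ.s≤s (ℕ.s≤s (ℕ.s≤s ℕ.z≤n))))))

  -- Raising k by b + 1 compensates for halving a, since 2^(b+1) (a/2)^(b+1) = a^(b+1), and lowers
  -- the fraction (m - k)/(b + 1) by exactly 1.
  log₂-upper-halve : ∀ X X′ {q} → (∀ {a} → upper X a → upper X′ (½ * a)) → Log₂Upper X q → Log₂Upper X′ (q - 1ℚ)
  log₂-upper-halve X X′ {q} halve (log₂-upper {a} m k b X<a power above) =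
    log₂-upper m (k ℕ.+ suc b) b (halve X<a) (≤-trans (≤-reflexive scale) power)
      (<by (q * ι (suc b) - (ι m - ι k)) (sub-pos above)
        (trans (cong (λ z → ι m - z + (q * ι (suc b) - (ι m - ι k))) (ι-homo-+ k (suc b)))
          (solve 4 (λ m k b q → m :- (k :+ b) :+ (q :* b :- (m :- k)) := (q :- con 1ℚ) :* b) refl (ι m) (ι k) (ι (suc b)) q)))
    where
    scale : ι 2 ^ℚ (k ℕ.+ suc b) * (½ * a) ^ℚ suc b ≡ ι 2 ^ℚ k * a ^ℚ suc b
    scale = trans (cong (_* (½ * a) ^ℚ suc b) (^ℚ-homo-+ (ι 2) k (suc b)))
      (trans (*-assoc (ι 2 ^ℚ k) (ι 2 ^ℚ suc b) ((½ * a) ^ℚ suc b)) (cong (ι 2 ^ℚ k *_)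
        (trans (sym (^ℚ-distrib-* (ι 2) (½ * a) (suc b)))
          (cong (_^ℚ suc b) (solve 1 (λ a → con (ι 2) :* (con ½ :* a) := a) refl a)))))

  e*-halve : ∀ t y {{_ : IsPositive y}} {a} → upper (e *ℝ fromℕ t *ℝ y) a → upper (fromℕ t *ℝ y) (½ * a)
  e*-halve t y {a} h =
    let et , r , et<et′ , y<r , etr<a = *-upper⁻ (e *ℝ fromℕ t) y h
        e′ , t′ , e<e′ , t<t′ , e′t′<et = *-upper⁻ e (fromℕ t) et<et′
        0≤t′ = ≤-trans (ι-nn t) (<⇒≤ t<t′)
    in *-upper⁺ (fromℕ t) y 0≤t′ t<t′ y<r (bound et r e′ t′ 0≤t′ (pos-upper y y<r) (lower<upper e 2<e e<e′) e′t′<et etr<a)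
    where
    bound : ∀ c r e′ t′ → 0ℚ ≤ t′ → 0ℚ < r → ι 2 < e′ → e′ * t′ < c → c * r < a → t′ * r < ½ * a
    bound c r e′ t′ 0≤t′ 0<r 2<e′ e′t′<c cr<a = <by (½ * ((e′ - ι 2) * t′ * r + (c - e′ * t′) * r + (a - c * r)))
      (*pos 0<½ (+-mono-≤-< (+nn (*nn (*nn (sub-nn (<⇒≤ 2<e′)) 0≤t′) (<⇒≤ 0<r)) (*nn (sub-nn (<⇒≤ e′t′<c)) (<⇒≤ 0<r))) (sub-pos cr<a)))
      (solve 5 (λ c r e t a → t :* r :+ con ½ :* ((e :- con (ι 2)) :* t :* r :+ (c :- e :* t) :* r :+ (a :- c :* r)) := con ½ :* a) refl c r e′ t′ a)

  -- The origin of the constant 7: 1/7 < 21/128. The witness q lies just below r/7, hence below the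
  -- product of cBSG and √ x.
  c√⁻¹-upper : ∀ x {{_ : IsPositive x}} {s} → upper ((√ x) ⁻¹) s → upper ((cBSG *ℝ √ x) ⁻¹) (ι 7 * s)
  c√⁻¹-upper x {s} √x⁻¹<s@(r , 0<r , r<√x , 1<sr) =
    let q , q<r/7 , 1<7sq = slack-below {r * seventh} {ι 7 * s} {1ℚ} (*pos (ι-pos 7) 0<s)
          (subst (1ℚ <_) (solve 2 (λ s r → s :* r := r :* con seventh :* (con (ι 7) :* s)) refl s r) 1<sr)
        0<q = pos-left q (<⇒≤ (*pos (ι-pos 7) 0<s)) (<-trans 0<1 1<7sq)
    in q , 0<q , *-lower⁺ cBSG (√ x) (<⇒≤ 0<seventh) (<⇒≤ 0<r) seventh<c r<√x (subst (q <_) (*-comm r seventh) q<r/7) ,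
       subst (1ℚ <_) (*-comm q (ι 7 * s)) 1<7sq
    where
    seventh : ℚ
    seventh = ℤ.+ 1 / 7
    0<seventh : 0ℚ < seventh
    0<seventh = *<* (ℤ.+<+ (ℕ.s≤s ℕ.z≤n))
    seventh<c : lower cBSG seventh
    seventh<c = subst (λ z → lower z seventh) (sym cBSG≡21/128) (toWitness {a? = seventh <? ℤ.+ 21 / 128} _)
    0<s : 0ℚ < s
    0<s = pos-upper ((√ x) ⁻¹) {s} √x⁻¹<s

  ceiling-upper : ∀ X T {v} → fromℕ T <ℝ X +ℝ 1ℝ → upper X v → ι T ≤ v + 1ℚ
  ceiling-upper X T {v} (r , T<r , (a , b , a<X , b<1 , r<a+b)) X<v =
    <⇒≤ (<-trans T<r (<-trans r<a+b (+-mono-< (lower<upper X a<X X<v) b<1)))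

  -- The ceiling adds less than 1 to a quantity bounded by 7 s (g - 1), where the -1 comes from e >
  -- 2. Since 7 s > 1, expanding this product pays for that 1.
  block-length-upper : ∀ α {{_ : IsPositive α}} t {{_ : ℕ.NonZero t}} ρ {{_ : IsPositive ρ}} T → α <ℝ 1ℝ → ρ <ℝ 1ℝ →
    fromℕ T <ℝ (cBSG *ℝ √ α) ⁻¹ *ℝ log₂ (fromℕ t *ℝ ρ ⁻¹) +ℝ 1ℝ →
    ∀ {s g} → upper ((√ α) ⁻¹) s → Log₂Upper (e *ℝ fromℕ t *ℝ ρ ⁻¹) g → ι T ≤ ι 7 * s * g
  block-length-upper α t ρ T α<1 ρ<1 T<X+1 {s} {g} √α⁻¹<s L<g = ≮⇒≥ λ 7sg<T →
    let 1<s = 1<√⁻¹ α α<1 {s} √α⁻¹<s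
        v , 7s[g-1]<v , v<T-1 = <-dense (gap 1<s 7sg<T)
    in <-irrefl {ι T} refl (≤-<-trans (ceiling-upper ((cBSG *ℝ √ α) ⁻¹ *ℝ log₂ (fromℕ t *ℝ ρ ⁻¹)) T {v} T<X+1
         (*-upper⁺ ((cBSG *ℝ √ α) ⁻¹) (log₂ (fromℕ t *ℝ ρ ⁻¹)) {{log₂-positive (fromℕ t *ℝ ρ ⁻¹) (1<ℕ* t (ρ ⁻¹) (1<⁻¹ ρ ρ<1))}}
           {ι 7 * s} {g - 1ℚ} {v} (*nn (ι-nn 7) (<⇒≤ (<-trans 0<1 1<s))) (c√⁻¹-upper α {s} √α⁻¹<s)
           (log₂-upper-halve (e *ℝ fromℕ t *ℝ ρ ⁻¹) (fromℕ t *ℝ ρ ⁻¹) (e*-halve t (ρ ⁻¹)) L<g) 7s[g-1]<v))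
         (<-≤-trans (+-monoˡ-< 1ℚ v<T-1) (≤-reflexive (solve 1 (λ t → t :- con 1ℚ :+ con 1ℚ := t) refl (ι T)))))
    where
    gap : 1ℚ < s → ι 7 * s * g < ι T → ι 7 * s * (g - 1ℚ) < ι T - 1ℚ
    gap 1<s 7sg<T = <by ((ι T - ι 7 * s * g) + (ι 7 * (s - 1ℚ) + ι 6))
      (+pos (sub-pos 7sg<T) (+pos (*pos (ι-pos 7) (sub-pos 1<s)) (ι-pos 6)))
      (solve 3 (λ t s g → con (ι 7) :* s :* (g :- con 1ℚ) :+ ((t :- con (ι 7) :* s :* g) :+ (con (ι 7) :* (s :- con 1ℚ) :+ con (ι 6))) := t :- con 1ℚ) refl (ι T) s g)

  Λ-positive : ∀ n α ρsnd ρcmp {{_ : IsPositive α}} {{_ : IsPositive ρsnd}} {{_ : IsPositive ρcmp}} →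
    α <ℝ 1ℝ → ρsnd <ℝ 1ℝ → ρcmp <ℝ 1ℝ → IsPositive (Λ n α ρsnd ρcmp)
  Λ-positive n α ρsnd ρcmp α<1 ρsnd<1 ρcmp<1 =
    +-positive (1ℝ +ℝ fromℕ n +ℝ log₂ (α ⁻¹) +ℝ log₂ (ρsnd ⁻¹)) (log₂ (ρcmp ⁻¹))
      {{+-positive (1ℝ +ℝ fromℕ n +ℝ log₂ (α ⁻¹)) (log₂ (ρsnd ⁻¹))
        {{+-positive (1ℝ +ℝ fromℕ n) (log₂ (α ⁻¹))
          {{+-positive 1ℝ (fromℕ n) {{fromℕ-positive {1}}} (λ q<0 → <-≤-trans q<0 (ι-nn n))}}
          (log₂⁻¹-nonNeg α α<1)}}
        (log₂⁻¹-nonNeg ρsnd ρsnd<1)}}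
      (log₂⁻¹-nonNeg ρcmp ρcmp<1)
    where
    log₂⁻¹-nonNeg : ∀ x {{_ : IsPositive x}} → x <ℝ 1ℝ → 0ℝ ≤ℝ log₂ (x ⁻¹)
    log₂⁻¹-nonNeg x x<1 = IsPositive⇒0≤ℝ (log₂ (x ⁻¹)) {{log₂-positive (x ⁻¹) (1<⁻¹ x x<1)}}

  -- K + 1 rather than K, so that the factor strictly exceeds fromℕ K.
  member-cost-upper : ∀ K α {{_ : IsPositive α}} Λ′ {{_ : IsPositive Λ′}} q →
    fromℕ q ≤ℝ fromℕ K *ℝ (α ⁻¹) ^ℝ 4 *ℝ Λ′ ^ℝ 3 →
    ∀ {s l} → upper ((√ α) ⁻¹) s → upper Λ′ l → ι q ≤ ι (suc K) * (s * s) ^ℚ 4 * l ^ℚ 3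
  member-cost-upper K α Λ′ q q≤ {s} {l} √α⁻¹<s Λ<l =
    fromℚ-≤-upper (fromℕ K *ℝ (α ⁻¹) ^ℝ 4 *ℝ Λ′ ^ℝ 3) q≤
      (*-upper⁺ (fromℕ K *ℝ (α ⁻¹) ^ℝ 4) (Λ′ ^ℝ 3) {{^-positive Λ′ 3}} {k * D} {F} (*nn 0≤k (<⇒≤ 0<D))
        (*-upper⁺ (fromℕ K) ((α ⁻¹) ^ℝ 4) {{^-positive (α ⁻¹) 4}} {κ} {D} (≤-trans (ι-nn K) (<⇒≤ K<κ)) K<κ
          (^-upper (α ⁻¹) 3 {s * s} (√⁻¹-upper-square α {s} √α⁻¹<s)) (*mono-<ʳ 0<D κ<k))
        (^-upper Λ′ 2 {l} Λ<l)
        (*mono-<ʳ 0<F (*mono-<ʳ 0<D k<K+1)))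
    where
    middle : ∃[ k ] ι K < k × k < ι (suc K)
    middle = <-dense (<by 1ℚ 0<1 (sym (ι-suc K)))
    k : ℚ
    k = proj₁ middle
    k<K+1 : k < ι (suc K)
    k<K+1 = proj₂ (proj₂ middle)
    below-middle : ∃[ κ ] ι K < κ × κ < k
    below-middle = <-dense (proj₁ (proj₂ middle))
    κ : ℚ
    κ = proj₁ below-middle
    K<κ : ι K < κ
    K<κ = proj₁ (proj₂ below-middle)
    κ<k : κ < k
    κ<k = proj₂ (proj₂ below-middle)
    0≤k : 0ℚ ≤ k
    0≤k = ≤-trans (ι-nn K) (<⇒≤ (<-trans K<κ κ<k))
    D F : ℚ
    D = (s * s) ^ℚ 4
    F = l ^ℚ 3
    0<s : 0ℚ < s
    0<s = pos-upper ((√ α) ⁻¹) {s} √α⁻¹<s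
    0<D : 0ℚ < D
    0<D = ^-pos 4 (*pos 0<s 0<s)
    0<F : 0ℚ < F
    0<F = ^-pos 3 (pos-upper Λ′ Λ<l)

  -- M is the floor of v. The query count needs one natural number that bounds every evaluation,
  -- whereas the cost hypothesis yields a rational.
  greatest-ℕ-≤ : ∀ {v} → 0ℚ ≤ v → ∃[ M ] ι M ≤ v × (∀ {q} → ι q ≤ v → q ℕ.≤ M)
  greatest-ℕ-≤ {v} 0≤v =
    let N , v<N = archimedes v
        m , v<m , m≤v+1 = ℕ-above N 0≤v v<N
    in below m v<m m≤v+1
    where
    below : ∀ m → v < ι m → ι m ≤ v + 1ℚ → ∃[ M ] ι M ≤ v × (∀ {q} → ι q ≤ v → q ℕ.≤ M)
    below zero    v<0   _      = ⊥-elim (<-irrefl refl (≤-<-trans 0≤v v<0))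
    below (suc M) v<m m≤v+1 = M ,
      subst₂ _≤_ (solve 1 (λ m → m :+ con 1ℚ :+ (:- con 1ℚ) := m) refl (ι M)) (solve 1 (λ v → v :+ con 1ℚ :+ (:- con 1ℚ) := v) refl v)
        (+-monoˡ-≤ (- 1ℚ) (subst (_≤ v + 1ℚ) (ι-suc M) m≤v+1)) ,
      λ q≤v → ℕ.≤-pred (ι-cancel (≤-<-trans q≤v v<m))

  -- The product is opened from the outside, and each power is reduced to a single base. Positivity
  -- of s, l and g then lets monotonicity rebuild the rational product from inside out.
  cost-upper⁻ : ∀ C t A {{_ : IsPositive A}} Λ′ {{_ : IsPositive Λ′}} L {{_ : IsPositive L}} {u} →
    upper (fromℕ C *ℝ (fromℕ t *ℝ A ^ℝ 9 *ℝ Λ′ ^ℝ 3 *ℝ L)) u →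
    ∃[ s ] ∃[ l ] ∃[ g ] upper A s × upper Λ′ l × upper L g × ι C * (ι t * s ^ℚ 9 * l ^ℚ 3 * g) ≤ u
  cost-upper⁻ C t A Λ′ L h =
    let c , r₁ , C<c , h₁ , cr₁<u    = *-upper⁻ (fromℕ C) (fromℕ t *ℝ A ^ℝ 9 *ℝ Λ′ ^ℝ 3 *ℝ L) h
        r₂ , g , h₂ , L<g , r₂g<r₁   = *-upper⁻ (fromℕ t *ℝ A ^ℝ 9 *ℝ Λ′ ^ℝ 3) L h₁
        r₃ , l₃ , h₃ , Λ³<l₃ , r₃l₃< = *-upper⁻ (fromℕ t *ℝ A ^ℝ 9) (Λ′ ^ℝ 3) h₂
        τ , s₉ , t<τ , A⁹<s₉ , τs₉<  = *-upper⁻ (fromℕ t) (A ^ℝ 9) h₃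
        s , A<s , s⁹≤s₉              = ^-upper⁻ A 9 A⁹<s₉
        l , Λ<l , l³≤l₃              = ^-upper⁻ Λ′ 3 Λ³<l₃
    in s , l , g , A<s , Λ<l , L<g ,
       combine {r₁ = r₁} {r₂} {r₃} {l₃} {s₉} (pos-upper A A<s) (pos-upper Λ′ Λ<l) (pos-upper L L<g) C<c t<τ s⁹≤s₉ l³≤l₃
         cr₁<u r₂g<r₁ r₃l₃< τs₉<
    where
    combine : ∀ {c τ s l g u r₁ r₂ r₃ l₃ s₉} → 0ℚ < s → 0ℚ < l → 0ℚ < g → ι C < c → ι t < τ → s ^ℚ 9 ≤ s₉ → l ^ℚ 3 ≤ l₃ →
      c * r₁ < u → r₂ * g < r₁ → r₃ * l₃ < r₂ → τ * s₉ < r₃ → ι C * (ι t * s ^ℚ 9 * l ^ℚ 3 * g) ≤ u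
    combine {c} {τ} {s} {l} {g} {u} {r₁} {r₂} {r₃} {l₃} {s₉} 0<s 0<l 0<g C<c t<τ s⁹≤s₉ l³≤l₃ h₁ h₂ h₃ h₄ =
      ≤-trans (*mono-≤ (ι-nn C) (≤-trans 0≤₁ ≤r₁) (<⇒≤ C<c) ≤r₁) (<⇒≤ h₁)
      where
      S F : ℚ
      S = s ^ℚ 9
      F = l ^ℚ 3
      0≤S : 0ℚ ≤ S
      0≤S = ^-nn 9 (<⇒≤ 0<s)
      0≤F : 0ℚ ≤ F
      0≤F = ^-nn 3 (<⇒≤ 0<l)
      ≤r₃ : ι t * S ≤ r₃
      ≤r₃ = ≤-trans (*mono-≤ (ι-nn t) (≤-trans 0≤S s⁹≤s₉) (<⇒≤ t<τ) s⁹≤s₉) (<⇒≤ h₄)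
      0≤₃ : 0ℚ ≤ ι t * S
      0≤₃ = *nn (ι-nn t) 0≤S
      ≤r₂ : ι t * S * F ≤ r₂
      ≤r₂ = ≤-trans (*mono-≤ 0≤₃ (≤-trans 0≤F l³≤l₃) ≤r₃ l³≤l₃) (<⇒≤ h₃)
      0≤₂ : 0ℚ ≤ ι t * S * F
      0≤₂ = *nn 0≤₃ 0≤F
      ≤r₁ : ι t * S * F * g ≤ r₁
      ≤r₁ = ≤-trans (*-monoʳ-≤-nonNeg g {{nonNegative (<⇒≤ 0<g)}} ≤r₂) (<⇒≤ h₂)
      0≤₁ : 0ℚ ≤ ι t * S * F * g
      0≤₁ = *nn 0≤₂ (<⇒≤ 0<g)

  fromℚ-≤-cost : ∀ C t A {{_ : IsPositive A}} Λ′ {{_ : IsPositive Λ′}} L {{_ : IsPositive L}} {p} →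
    (∀ s l g → upper A s → upper Λ′ l → upper L g → p ≤ ι C * (ι t * s ^ℚ 9 * l ^ℚ 3 * g)) →
    fromℚ p ≤ℝ fromℕ C *ℝ (fromℕ t *ℝ A ^ℝ 9 *ℝ Λ′ ^ℝ 3 *ℝ L)
  fromℚ-≤-cost C t A Λ′ L p≤ = fromℚ-≤ℝ (fromℕ C *ℝ (fromℕ t *ℝ A ^ℝ 9 *ℝ Λ′ ^ℝ 3 *ℝ L)) λ h →
    let s , l , g , A<s , Λ<l , L<g , cost≤u = cost-upper⁻ C t A Λ′ L h in ≤-trans (p≤ s l g A<s Λ<l L<g) cost≤u

  -- The exponent 9/2 arises here: with s above α^(-1/2), the block length gives one factor s and
  -- one evaluation gives (s²)^4, together s^9.
  total-cost : ∀ K t T M s l g → 0ℚ ≤ s → 0ℚ ≤ g → ι T ≤ ι 7 * s * g → ι M ≤ ι (suc K) * (s * s) ^ℚ 4 * l ^ℚ 3 →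
    ι (t ℕ.* (T ℕ.* M)) ≤ ι (7 ℕ.* suc K) * (ι t * s ^ℚ 9 * l ^ℚ 3 * g)
  total-cost K t T M s l g 0≤s 0≤g T≤ M≤ = ≤-trans
    (≤-reflexive (trans (ι-homo-* t (T ℕ.* M)) (cong (ι t *_) (ι-homo-* T M))))
    (≤-trans (*-monoˡ-≤-nonNeg (ι t) {{nonNegative (ι-nn t)}} (*mono-≤ (ι-nn T) (≤-trans (ι-nn M) M≤) T≤ M≤))
      (≤-reflexive (trans rearrange (cong (_* (ι t * s ^ℚ 9 * l ^ℚ 3 * g)) (sym (ι-homo-* 7 (suc K)))))))
    where
    s⁸ : (s * s) ^ℚ 4 ≡ s ^ℚ 8
    s⁸ = trans (^ℚ-distrib-* s s 4) (sym (^ℚ-homo-+ s 4 4))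
    rearrange : ι t * (ι 7 * s * g * (ι (suc K) * (s * s) ^ℚ 4 * l ^ℚ 3)) ≡ ι 7 * ι (suc K) * (ι t * s ^ℚ 9 * l ^ℚ 3 * g)
    rearrange = trans (cong (λ z → ι t * (ι 7 * s * g * (ι (suc K) * z * l ^ℚ 3))) s⁸)
      (solve 7 (λ t c s g k p f → t :* (c :* s :* g :* (k :* p :* f)) := c :* k :* (t :* (s :* p) :* f :* g)) refl
        (ι t) (ι 7) s g (ι (suc K)) (s ^ℚ 8) (l ^ℚ 3))

  1<* : ∀ x y → 1ℝ <ℝ x → 1ℝ <ℝ y → 1ℝ <ℝ x *ℝ y
  1<* x y (a , 1<a , a<x) (b , 1<b , b<y) = let q , 1<q , q<ab = <-dense (*mono-< 0<1 0<1 1<a 1<b) in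
    q , 1<q , *-lower⁺ x y (<⇒≤ (<-trans 0<1 1<a)) (<⇒≤ (<-trans 0<1 1<b)) a<x b<y q<ab

  1<e*ℕ : ∀ t {{_ : ℕ.NonZero t}} → 1ℝ <ℝ e *ℝ fromℕ t
  -- As t may be 1 and is not in its own lower cut, 7/8 stands for t; then 2 · 7/8 = 7/4 leaves room
  -- for 3/2.
  1<e*ℕ t = threeHalves , 1<3/2 , *-lower⁺ e (fromℕ t) {ι 2} {ℤ.+ 7 / 8} {threeHalves} (ι-nn 2) 0≤7/8 2<e
    (<-≤-trans 7/8<1 (ι-mono {1} {t} (ℕ.>-nonZero⁻¹ t))) 3/2<7/4
    where
    threeHalves : ℚ
    threeHalves = ℤ.+ 3 / 2
    1<3/2 : 1ℚ < threeHalves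
    1<3/2 = toWitness {a? = 1ℚ <? threeHalves} _
    0≤7/8 : 0ℚ ≤ ℤ.+ 7 / 8
    0≤7/8 = toWitness {a? = 0ℚ ≤? ℤ.+ 7 / 8} _
    7/8<1 : ℤ.+ 7 / 8 < 1ℚ
    7/8<1 = toWitness {a? = (ℤ.+ 7 / 8) <? 1ℚ} _
    3/2<7/4 : threeHalves < ι 2 * (ℤ.+ 7 / 8)
    3/2<7/4 = toWitness {a? = threeHalves <? ι 2 * (ℤ.+ 7 / 8)} _

-- Assembly of the four claims.

module Conclusion where
  open Notation
  open Cuts
  open Failure
  open Bounds
  open Law
  open Cost

  ÷-cancel : ∀ {p} r q {{_ : NonZero q}} → p ≡ r * q → p ÷ q ≡ r
  ÷-cancel r q refl = trans (*-assoc r q (1/ q)) (trans (cong (r *_) (*-inverseʳ q)) (*-identityʳ r))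

  0<⇒nonZero : ∀ {p} → 0ℚ < p → NonZero p
  0<⇒nonZero {p} 0<p = pos⇒nonZero p {{positive 0<p}}

  lower-bound⇒nonZero : ∀ x {{_ : IsPositive x}} y → x ≤ℝ fromℕ y → ℕ.NonZero y
  lower-bound⇒nonZero x {{is-positive 0<w w<x}} y x≤y = ℕ.>-nonZero (ι-cancel {0} {y} (<-trans 0<w (x≤y w<x)))

  -- It suffices to treat each triple of rational bounds s, l, g separately; the common budget M for
  -- one evaluation is chosen afresh for each triple.
  query-bound : ∀ K {n} (S : Subset n) (member : Point n → Query n Bool) α {{_ : IsPositive α}} Λ′ {{_ : IsPositive Λ′}} → α <ℝ 1ℝ →
    (∀ x → fromℕ (queryCount S (member x)) ≤ℝ fromℕ K *ℝ (α ⁻¹) ^ℝ 4 *ℝ Λ′ ^ℝ 3) →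
    ∀ t {{_ : ℕ.NonZero t}} ρ {{_ : IsPositive ρ}} → ρ <ℝ 1ℝ → ∀ T →
    fromℕ T <ℝ (cBSG *ℝ √ α) ⁻¹ *ℝ log₂ (fromℕ t *ℝ ρ ⁻¹) +ℝ 1ℝ →
    fromℕ (maxQueries S (sampleTuple member t T)) ≤ℝ
      fromℕ (7 ℕ.* suc K) *ℝ (fromℕ t *ℝ ((√ α) ⁻¹) ^ℝ 9 *ℝ Λ′ ^ℝ 3 *ℝ log₂ (e *ℝ fromℕ t *ℝ ρ ⁻¹))
  query-bound K S member α {{α>0}} Λ′ α<1 cost t {{t≢0}} ρ {{ρ>0}} ρ<1 T T<X+1 =
    fromℚ-≤-cost (7 ℕ.* suc K) t ((√ α) ⁻¹) Λ′ (log₂ (e *ℝ fromℕ t *ℝ ρ ⁻¹)) {{log>0}} cost-≤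
    where
    log>0 : IsPositive (log₂ (e *ℝ fromℕ t *ℝ ρ ⁻¹))
    log>0 = log₂-positive (e *ℝ fromℕ t *ℝ ρ ⁻¹) (1<* (e *ℝ fromℕ t) (ρ ⁻¹) (1<e*ℕ t) (1<⁻¹ ρ ρ<1))
    cost-≤ : ∀ s l g → upper ((√ α) ⁻¹) s → upper Λ′ l → upper (log₂ (e *ℝ fromℕ t *ℝ ρ ⁻¹)) g →
      ι (maxQueries S (sampleTuple member t T)) ≤ ι (7 ℕ.* suc K) * (ι t * s ^ℚ 9 * l ^ℚ 3 * g)
    cost-≤ s l g √α⁻¹<s Λ<l L<g =
      let M , M≤ , member≤M = greatest-ℕ-≤ v≥0 in
      with-budget M M≤ λ x → member≤M (member-cost-upper K α Λ′ (queryCount S (member x)) (cost x) {s} {l} √α⁻¹<s Λ<l)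
      where
      0≤s : 0ℚ ≤ s
      0≤s = <⇒≤ (pos-upper ((√ α) ⁻¹) {s} √α⁻¹<s)
      0≤g : 0ℚ ≤ g
      0≤g = <⇒≤ (pos-upper (log₂ (e *ℝ fromℕ t *ℝ ρ ⁻¹)) {{log>0}} L<g)
      v≥0 : 0ℚ ≤ ι (suc K) * (s * s) ^ℚ 4 * l ^ℚ 3
      v≥0 = *nn (*nn (ι-nn (suc K)) (^-nn 4 (*nn 0≤s 0≤s))) (^-nn 3 (<⇒≤ (pos-upper Λ′ Λ<l)))
      T≤ : ι T ≤ ι 7 * s * g
      T≤ = block-length-upper α {{α>0}} t {{t≢0}} ρ {{ρ>0}} T α<1 ρ<1 T<X+1 {s} {g} √α⁻¹<s L<g
      with-budget : ∀ M → ι M ≤ ι (suc K) * (s * s) ^ℚ 4 * l ^ℚ 3 → (∀ x → queryCount S (member x) ℕ.≤ M) →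
        ι (maxQueries S (sampleTuple member t T)) ≤ ι (7 ℕ.* suc K) * (ι t * s ^ℚ 9 * l ^ℚ 3 * g)
      with-budget M M≤ member≤M = begin
        ι (maxQueries S (sampleTuple member t T))           ≤⟨ ι-mono {maxQueries S (sampleTuple member t T)} {t ℕ.* (T ℕ.* M)} (queries-sampleTuple S member member≤M t T) ⟩
        ι (t ℕ.* (T ℕ.* M))                                 ≤⟨ total-cost K t T M s l g 0≤s 0≤g T≤ M≤ ⟩
        ι (7 ℕ.* suc K) * (ι t * s ^ℚ 9 * l ^ℚ 3 * g)       ∎
        where open ≤-Reasoning

  module _ (K : ℕ) {n : ℕ} (S : Subset n) {{_ : ℕ.NonZero (card S)}}
    (α ρsnd ρcmp : ℝ) {{α>0 : IsPositive α}} {{_ : IsPositive ρsnd}} {{_ : IsPositive ρcmp}}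
    (D : NonfailureRecord K S α ρsnd ρcmp)
    (cs≤y : cBSG *ℝ √ α *ℝ fromℕ (card S) ≤ℝ fromℕ (card (NonfailureRecord.Y D)))
    (t : ℕ) {{t≢0 : ℕ.NonZero t}} (ρ : ℝ) {{ρ>0 : IsPositive ρ}} (T : ℕ)
    (X≤T : (cBSG *ℝ √ α) ⁻¹ *ℝ log₂ (fromℕ t *ℝ ρ ⁻¹) ≤ℝ fromℕ T) where

    open NonfailureRecord D

    Y-nonEmpty : ℕ.NonZero (card Y)
    Y-nonEmpty = lower-bound⇒nonZero (cBSG *ℝ √ α *ℝ fromℕ (card S)) (card Y) cs≤y

    open Rejection S member {{Y-nonEmpty}} Y⊆S hiding (Y)

    reject≤1 : reject ≤ 1ℚ
    reject≤1 = ≤by (ι (card Y) * (ℤ.+ 1 / card S)) (*nn (ι-nn (card Y)) (0≤1/ (card S)))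
      (solve 1 (λ p → con 1ℚ :- p :+ p := con 1ℚ) refl (ι (card Y) * (ℤ.+ 1 / card S)))

    t*reject^T≤ : ∀ {u} → upper ρ u → ι t * reject ^ℚ T ≤ u
    t*reject^T≤ = blocks-fail-bound (card S) (card Y) (cBSG *ℝ √ α) t {{t≢0}} ρ {{ρ>0}} T (1/-inverse (card S))
      (0≤1/ (card S)) 0≤reject cs≤y X≤T

    Pr-fail : fromℚ (Pr S (sampleTuple member t T) is-nothing) ≤ℝ ρ
    Pr-fail = fromℚ-≤ℝ ρ λ ρ<u → ≤-trans (Pr-nothing t T (^-nn T 0≤reject) (^-≤1 T 0≤reject reject≤1)) (t*reject^T≤ ρ<u)

    -- As t ≥ 1, `reject`^T is at most t times itself, hence at most a rational u with ρ < u < 1.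
    0<accept : ρ <ℝ 1ℝ → 0ℚ < accept T
    0<accept (u , ρ<u , u<1) = sub-pos (≤-<-trans (≤-trans (≤-trans (≤-reflexive (sym (*-identityˡ (reject ^ℚ T))))
      (*-monoʳ-≤-nonNeg (reject ^ℚ T) {{nonNegative (^-nn T 0≤reject)}} (ι-mono {1} {t} (ℕ.>-nonZero⁻¹ t)))) (t*reject^T≤ ρ<u)) u<1)

    -- The probability of each output is its product-uniform weight times `accept T ^ℚ t`, which is
    -- exactly the success probability and cancels in the quotient.
    conditional-law : ρ <ℝ 1ℝ → Σ[ success≢0 ∈ NonZero (Pr S (sampleTuple member t T) is-just) ]
      ∀ v → Pr[ v isOutput_ ∣ is-just ] S (sampleTuple member t T) {{success≢0}} ≡ uniform^⊗ Y {{Y-nonEmpty}} v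
    conditional-law ρ<1 = success≢0 , λ v → ÷-cancel (uniform^⊗ Y {{Y-nonEmpty}} v) (Pr S (sampleTuple member t T) is-just) {{success≢0}}
        (trans (Pr-output T v) (cong (uniform^⊗ Y {{Y-nonEmpty}} v *_) (sym (Pr-just t T))))
      where
      success≢0 : NonZero (Pr S (sampleTuple member t T) is-just)
      success≢0 = 0<⇒nonZero (subst (0ℚ <_) (sym (Pr-just t T)) (^-pos t (0<accept ρ<1)))

open Notation using (_,_)
open Conclusion
open Cost using (samples-sampleTuple)
open Bounds using (Λ-positive)
open import Data.Maybe using (is-just; is-nothing)
open import Data.Nat using (ℕ; NonZero; _≤_; _*_)
open import Data.Product using (Σ-syntax; _×_)
open import Data.Vec using (Vec)
open import Data.Rational as ℚ using (ℚ)
open import Relation.Binary.PropositionalEquality using (_≡_)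

proposition4p9 : ∀ (K : ℕ) → Σ[ C ∈ ℕ ]
    ∀ {n : ℕ} (S : Subset n) {{_ : NonZero (card S)}}
    (α ρsnd ρcmp : ℝ) {{_ : IsPositive α}} {{_ : IsPositive ρsnd}} {{_ : IsPositive ρcmp}} →
    α <ℝ 1ℝ → ρsnd <ℝ 1ℝ → ρcmp <ℝ 1ℝ →
    (D : NonfailureRecord K S α ρsnd ρcmp) →
    let open NonfailureRecord D in
    cBSG *ℝ √ α *ℝ fromℕ (card S) ≤ℝ fromℕ (card Y) →
    (t : ℕ) {{_ : NonZero t}} (ρsamp : ℝ) {{_ : IsPositive ρsamp}} → ρsamp <ℝ 1ℝ →
    (T : ℕ) → IsCeiling T ((cBSG *ℝ √ α) ⁻¹ *ℝ log₂ (fromℕ t *ℝ ρsamp ⁻¹)) →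
    let procedure = sampleTuple member t T in
    fromℚ (Pr S procedure is-nothing) ≤ℝ ρsamp
    × (Σ[ Y≢∅ ∈ NonZero (card Y) ] Σ[ success≢0 ∈ ℚ.NonZero (Pr S procedure is-just) ]
    ∀ (v : Vec (Point n) t) →
    Pr[ v isOutput_ ∣ is-just ] S procedure {{success≢0}} ≡ uniform^⊗ Y {{Y≢∅}} v)
    × maxSamples S procedure ≤ t * T
    × fromℕ (maxQueries S procedure) ≤ℝ
    fromℕ C *ℝ (fromℕ t *ℝ ((√ α) ⁻¹) ^ℝ 9 *ℝ Λ n α ρsnd ρcmp ^ℝ 3
    *ℝ log₂ (e *ℝ fromℕ t *ℝ ρsamp ⁻¹))
proposition4p9 K = 7 * ℕ.suc K , λ {n} S α ρsnd ρcmp {{α>0}} α<1 ρsnd<1 ρcmp<1 D cs≤y t {{t≢0}} ρ {{ρ>0}} ρ<1 T (X≤T , T<X+1) →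
  let open NonfailureRecord D in
  Pr-fail K S α ρsnd ρcmp {{α>0}} D cs≤y t {{t≢0}} ρ {{ρ>0}} T X≤T ,
  (Y-nonEmpty K S α ρsnd ρcmp {{α>0}} D cs≤y t {{t≢0}} ρ {{ρ>0}} T X≤T ,
   conditional-law K S α ρsnd ρcmp {{α>0}} D cs≤y t {{t≢0}} ρ {{ρ>0}} T X≤T ρ<1) ,
  samples-sampleTuple S member t T ,
  query-bound K S member α {{α>0}} (Λ n α ρsnd ρcmp) {{Λ-positive n α ρsnd ρcmp α<1 ρsnd<1 ρcmp<1}} α<1 member-cost
    t {{t≢0}} ρ {{ρ>0}} ρ<1 T T<X+1
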